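{- Let $S$ be a semigroup (written additively, not necessarily commutative). The following assertions are equivalent: (1) The family of proper IP sets in $S$ is partition regular. (2) Every bijective sequence $a_1,a_2,\dotsc$ in $S$ has a proper sumsequence. (3) $S$ has no subsemigroup isomorphic to (or of) any of the following types: (a) an infinite semigroup $S'$ such that $S'+S'=\{s+t : s,t\in S'\}$ is finite; (b) the fan semilattice: the set $\mathbb{N}$ with operation $m\wedge m=m$ and $m\wedge n:=1$ for distinct $m,n$; (c) the semigroup $(\mathbb{N}\times\mathbb{N})\cup\{0\}$ with $0+(m,n)=(m,n)+0=0+0=0$ and $(m_1,n_1)+(m_2,n_2):=(m_1,n_1+n_2)$ if $m_1=m_2$, and $:=0$ otherwise. (4) For each bijective sequence $a_1,a_2,\dotsc$ in $S$ and each finite coloring of $S$, there is a bijective sumsequence $b_1,b_2,\dotsc$ of $a_1,a_2,\dotsc$ such that the set $\mathrm{FS}(b_1,b_2,\dotsc)$ is monochromatic. (5) For each bijective sequence $a_1,a_2,\dotsc$ in $S$ and each finite coloring of $S$, there is a proper sumsequence $b_1,b_2,\dotsc$ of $a_1,a_2,\dotsc$ such that the set $\mathrm{FS}(b_1,b_2,\dotsc)$ is monochromatic.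
   Context: Semigroups are written additively even when noncommutative. For a sequence $a_1,a_2,\dotsc$ and a nonempty finite set $F=\{i_1<\dotsb<i_m\}\subseteq\mathbb{N}$, $a_F:=a_{i_1}+\dotsb+a_{i_m}$, and $\mathrm{FS}(a_1,a_2,\dotsc):=\{a_F : F\subseteq\mathbb{N}\text{ finite nonempty}\}$. A proper IP set in $S$ is a subset of $S$ containing $\mathrm{FS}(a_1,a_2,\dotsc)$ for some bijective (i.e., injective) sequence $a_1,a_2,\dotsc$ in $S$. A family of sets is partition regular if for each finite partition of a set in the family, some piece of the partition is in the family. For finite $F_1,F_2\subseteq\mathbb{N}$, $F_1<F_2$ means every element of $F_1$ is smaller than every element of $F_2$. A sumsequence of $a_1,a_2,\dotsc$ is a sequence $a_{F_1},a_{F_2},\dotsc$ for nonempty finite sets $F_1<F_2<\dotsb$. A sequence is proper if $a_{F_1}\neq a_{F_2}$ for all nonempty finite $F_1<F_2$. A set is monochromatic for a coloring if all its elements have the same color. -}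

module Defs where

open import Level using (0ℓ)
open import Data.Nat using (ℕ; zero; suc; _<_; _≟_)
open import Data.Nat.Base as ℕ using ()
open import Data.Fin using (Fin)
open import Data.Product using (Σ; ∃; _×_; _,_)
open import Data.List using (List)
open import Data.List.NonEmpty using (List⁺; toList; foldr₁)
open import Data.List.Relation.Unary.Linked using (Linked)
open import Data.List.Membership.Propositional using (_∈_)
open import Relation.Nullary using (¬_; yes; no)
open import Relation.Binary.PropositionalEquality using (_≡_; _≢_)
open import Function.Definitions using (Injective)

record FinSet : Set where
  constructor fset
  field
    elems : List⁺ ℕ
    incr  : Linked _<_ (toList elems)
open FinSet public

_≺_ : FinSet → FinSet → Set
F₁ ≺ F₂ = ∀ {i j} → i ∈ toList (elems F₁) → j ∈ toList (elems F₂) → i < j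

-- A "bijective" sequence in the paper's sense = injective map ℕ → S.
Bijective : {S : Set} → (ℕ → S) → Set
Bijective a = Injective _≡_ _≡_ a

FiniteP : {S : Set} → (S → Set) → Set
FiniteP {S} P = Σ (List S) λ xs → ∀ x → P x → x ∈ xs

InfiniteP : {S : Set} → (S → Set) → Set
InfiniteP P = ¬ FiniteP P

module _ {S : Set} (_+_ : S → S → S) where

  sumF : (ℕ → S) → FinSet → S
  sumF a F = foldr₁ _+_ (Data.List.NonEmpty.map a (elems F))

  FS : (ℕ → S) → S → Set
  FS a x = Σ FinSet λ F → sumF a F ≡ x

  ProperIP : (S → Set) → Set
  ProperIP A = Σ (ℕ → S) λ a → Bijective a × (∀ x → FS a x → A x)

  Sumsequence : (ℕ → S) → (ℕ → S) → Set
  Sumsequence a b = Σ (ℕ → FinSet) λ F →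
    (∀ n → F n ≺ F (suc n)) × (∀ n → b n ≡ sumF a (F n))

  Proper : (ℕ → S) → Set
  Proper a = ∀ F₁ F₂ → F₁ ≺ F₂ → sumF a F₁ ≢ sumF a F₂

  Monochromatic : {k : ℕ} → (S → Fin k) → (S → Set) → Set
  Monochromatic {k} c P = Σ (Fin k) λ i → ∀ x → P x → c x ≡ i

  IsSubsemigroup : (S → Set) → Set
  IsSubsemigroup T = ∀ x y → T x → T y → T (x + y)

  _⊕_ : (S → Set) → (S → Set) → S → Set
  (T ⊕ U) x = Σ S λ s → Σ S λ t → T s × U t × x ≡ s + t

  -- S contains a copy of (X, _∘_): an injective homomorphism X → S
  -- (its image is a subsemigroup of S isomorphic to X).
  Embeds : {X : Set} → (X → X → X) → Set
  Embeds {X} _∘_ = Σ (X → S) λ f →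
    Injective _≡_ _≡_ f × (∀ x y → f (x ∘ y) ≡ f x + f y)

-- (b) the fan semilattice.  Carrier ℕ (paper's n ≥ 1 shifted to n - 1,
-- so the paper's bottom element 1 is 0 here):  m ∧ m = m, m ∧ n = 0.

fan : ℕ → ℕ → ℕ
fan m n with m ≟ n
... | yes _ = m
... | no  _ = 0

-- (c) (ℕ × ℕ) ∪ {0}.  Paper's positive (m , n) is represented by
-- pair (m - 1) (n - 1); so second coordinates add as
-- (n₁ + 1) + (n₂ + 1) = (n₁ + n₂ + 1) + 1.

data C : Set where
  zeroC : C
  pair  : ℕ → ℕ → C

_⊞_ : C → C → C
zeroC ⊞ _ = zeroC
pair _ _ ⊞ zeroC = zeroC
pair m₁ n₁ ⊞ pair m₂ n₂ with m₁ ≟ m₂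
... | yes _ = pair m₁ (suc (n₁ ℕ.+ n₂))
... | no  _ = zeroC

{-# OPTIONS --safe #-}

-- The assertions are equivalent through (2) ⇒ (5) ⇒ (4) ⇒ (1) ⇒ (3) ⇒ (2). Since sumsequences of proper
-- sequences are proper, (2) ⇒ (5) is Hindman's theorem, for which Baumgartner's argument is used.
-- For (1) ⇒ (3), each forbidden semigroup contains a proper IP set A such that the sums of two distinct
-- elements of A lie in a finite set; the colouring by membership in this finite set contradicts (1).
--
-- For (3) ⇒ (2), call s unavoidable in an injective sequence b if s is a finite sum of every injective
-- sumsequence of b. If no injective sumsequence of a has an unavoidable element, a proper sumsequence
-- is built greedily, each time avoiding the finitely many sums obtained so far. An unavoidable s has
-- finite order, so there is an unavoidable idempotent e. As the sums of b cannot all avoid a finite set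
-- Z ∋ e, there are a sum x ∉ Z and a subsequence (b_ψ(j)) with x + b_ψ(j) ∈ Z for all j.
-- If e + FS(b_N, b_N+1, …) is infinite for all N, we may assume that e is a left identity of b, and
-- taking Z = {e} leads to an injective sumsequence avoiding e. Otherwise the sets Z containing
-- V = {e} ∪ (e + FS) lead, by Ramsey's theorem, to an injective sequence x_0, x_1, … with x_i + x_j = s
-- for all i < j and with e a sum of terms. Multiples w_i of the x_i then satisfy w_i + w_j = e for i ≠ j,
-- and the orders of the w_i decide which of the semigroups (a), (b), (c) occurs.
module Submission where

open import Defs
open import Level using (0ℓ; lift; lower)
open import Data.Nat using (ℕ; zero; suc; _+_; _*_; _<_; _≤_; z≤n; s≤s; _≟_)
open import Data.Nat.Properties hiding (_≟_)
open import Data.Nat.Solver using (module +-*-Solver)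
open import Data.Fin using (Fin; zero; suc)
open import Data.Unit using (⊤; tt)
open import Data.Empty using (⊥; ⊥-elim)
open import Data.Product using (Σ; _×_; _,_; proj₁; proj₂)
open import Data.Sum using (_⊎_; inj₁; inj₂)
open import Data.List using (List; []; _∷_; _++_; map; allFin; applyUpTo)
open import Data.List.NonEmpty using (_∷_; toList; foldr₁)
open import Data.List.Membership.Propositional using (_∈_; _∉_)
open import Data.List.Membership.Propositional.Properties
  using (∈-++⁺ˡ; ∈-++⁺ʳ; ∈-++⁻; ∈-map⁺; ∈-map⁻; ∈-allFin; ∈-applyUpTo⁺)
open import Data.List.Relation.Unary.Any using (here; there)
open import Data.List.Relation.Unary.Linked using (Linked; [-]; _∷_)
open import Relation.Nullary using (¬_; Dec; yes; no; contradiction)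
open import Relation.Nullary.Decidable using (map′)
open import Relation.Binary.Definitions using (tri<; tri≈; tri>)
open import Relation.Binary.PropositionalEquality
  using (_≡_; _≢_; refl; sym; trans; cong; cong₂; subst; module ≡-Reasoning)
open import Algebra.Structures using (IsSemigroup)
open import Function using (_∘_; id)
open import Function.Bundles using (_⇔_; mk⇔)
open import Axiom.ExcludedMiddle using (ExcludedMiddle)

-- Infinite subsets of ℕ and Ramsey's theorem for pairs

Incr : (ℕ → ℕ) → Set
Incr φ = ∀ n → φ n < φ (suc n)

Inf : (ℕ → Set) → Set
Inf P = ∀ N → Σ ℕ λ n → N ≤ n × P n

incr-< : ∀ {φ} → Incr φ → ∀ {i j} → i < j → φ i < φ j
incr-< {φ} φ↑ {i} {suc j} (s≤s i≤j) with m≤n⇒m<n∨m≡n i≤j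
... | inj₁ i<j  = <-trans (incr-< φ↑ i<j) (φ↑ j)
... | inj₂ refl = φ↑ j

incr-injective : ∀ {φ} → Incr φ → Bijective φ
incr-injective φ↑ {i} {j} eq with <-cmp i j
... | tri< i<j _ _ = contradiction eq (<⇒≢ (incr-< φ↑ i<j))
... | tri≈ _ i≡j _ = i≡j
... | tri> _ _ j<i = contradiction (sym eq) (<⇒≢ (incr-< φ↑ j<i))

n≤incr : ∀ {φ} → Incr φ → ∀ n → n ≤ φ n
n≤incr φ↑ zero    = z≤n
n≤incr φ↑ (suc n) = ≤-trans (s≤s (n≤incr φ↑ n)) (φ↑ n)

incr-∘ : ∀ {φ ψ} → Incr φ → Incr ψ → Incr (φ ∘ ψ)
incr-∘ φ↑ ψ↑ n = incr-< φ↑ (ψ↑ n)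

incr-+ : ∀ N → Incr (N +_)
incr-+ N n = +-monoʳ-< N (n<1+n n)

incr-0≤ : ∀ {φ} → Incr φ → ∀ k → φ 0 ≤ φ k
incr-0≤ φ↑ zero    = ≤-refl
incr-0≤ φ↑ (suc k) = <⇒≤ (incr-< φ↑ (s≤s z≤n))

bijective-∘ : ∀ {X : Set} {a : ℕ → X} {φ} → Bijective a → Incr φ → Bijective (a ∘ φ)
bijective-∘ a-inj φ↑ eq = incr-injective φ↑ (a-inj eq)

module _ {X : Set} where

  ≢⇒injective : {b : ℕ → X} → (∀ {i j} → i < j → b i ≢ b j) → Bijective b
  ≢⇒injective ne {i} {j} eq with <-cmp i j
  ... | tri< i<j _ _ = contradiction eq (ne i<j)
  ... | tri≈ _ i≡j _ = i≡j
  ... | tri> _ _ j<i = contradiction (sym eq) (ne j<i)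

  -- Dependent choice of an injective sequence: `L` holds the terms chosen so far, and the markers
  -- `N` and `m` delimit the interval in which the new term is sought.
  module _ {W : ℕ → ℕ → X → Set}
           (pick : ∀ N (L : List X) → Σ ℕ λ m → Σ X λ y → W N m y × y ∉ L) where

    private
      state : ℕ → ℕ × List X
      state zero    = 0 , []
      state (suc k) = let N , L = state k ; m , y , _ = pick N L in m , y ∷ L

      chosen : ℕ → X
      chosen k = let N , L = state k in proj₁ (proj₂ (pick N L))

      chosen-∈ : ∀ {i k} → i < k → chosen i ∈ proj₂ (state k)
      chosen-∈ {i} {suc k} (s≤s i≤k) with m≤n⇒m<n∨m≡n i≤k
      ... | inj₁ i<k  = there (chosen-∈ i<k)
      ... | inj₂ refl = here refl

    abstract
      select : Σ (ℕ → ℕ) λ g → Σ (ℕ → X) λ b → (∀ k → W (g k) (g (suc k)) (b k)) × Bijective b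
      select = proj₁ ∘ state , chosen
             , (λ k → proj₁ (proj₂ (proj₂ (pick _ _))))
             , ≢⇒injective λ {i} {j} i<j eq →
                 proj₂ (proj₂ (proj₂ (pick _ _))) (subst (_∈ proj₂ (state j)) eq (chosen-∈ i<j))

minimum : FinSet → ℕ
minimum (fset (i ∷ _) _) = i

lastOf : ℕ → List ℕ → ℕ
lastOf i []      = i
lastOf _ (j ∷ l) = lastOf j l

maximum : FinSet → ℕ
maximum (fset (i ∷ l) _) = lastOf i l

minimum-∈ : ∀ F → minimum F ∈ toList (elems F)
minimum-∈ (fset (_ ∷ _) _) = here refl

maximum-∈ : ∀ F → maximum F ∈ toList (elems F)
maximum-∈ (fset (i ∷ l) _) = go i l
  where
  go : ∀ i l → lastOf i l ∈ i ∷ l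
  go i []      = here refl
  go i (j ∷ l) = there (go j l)

module Classical (em : ExcludedMiddle (Level.suc 0ℓ)) where

  abstract
    lem : (P : Set) → Dec P
    lem P = map′ lower lift (em {Level.Lift _ P})

  abstract
    by-contra : {P : Set} → ¬ ¬ P → P
    by-contra {P} ¬¬p with lem P
    ... | yes p = p
    ... | no ¬p = ⊥-elim (¬¬p ¬p)

  abstract
    inf⊎fin : (P : ℕ → Set) → Inf P ⊎ Σ ℕ λ N → ∀ n → N ≤ n → ¬ P n
    inf⊎fin P with lem (Inf P)
    ... | yes inf = inj₁ inf
    ... | no ¬inf = inj₂ (by-contra λ none → ¬inf λ N → by-contra λ ¬n →
                      none (N , λ n N≤n p → ¬n (n , N≤n , p)))

  abstract
    enumerate : {P : ℕ → Set} → Inf P → Σ (ℕ → ℕ) λ φ → Incr φ × ∀ k → P (φ k)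
    enumerate {P} inf = φ , (λ n → proj₁ (proj₂ (inf (suc (φ n))))) , holds
      where
      φ : ℕ → ℕ
      φ zero    = proj₁ (inf 0)
      φ (suc n) = proj₁ (inf (suc (φ n)))
      holds : ∀ k → P (φ k)
      holds zero    = proj₂ (proj₂ (inf 0))
      holds (suc k) = proj₂ (proj₂ (inf (suc (φ k))))

  inf-≥ : {P : ℕ → Set} → Inf P → ∀ M → Inf (λ n → P n × M ≤ n)
  inf-≥ inf M N =
    let n , le , p = inf (N + M) in n , m+n≤o⇒m≤o N le , p , m+n≤o⇒n≤o N le

  thin : (P : ℕ → Set) → Inf P ⊎ Σ (ℕ → ℕ) λ φ → Incr φ × ∀ k → ¬ P (φ k)
  thin P with inf⊎fin P
  ... | inj₁ inf     = inj₁ inf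
  ... | inj₂ (N , f) = inj₂ ((N +_) , incr-+ N , λ k → f _ (m≤m+n N k))

  module _ {X : Set} where

    abstract
      pigeonhole : (f : ℕ → X) (xs : List X) {P : ℕ → Set} → Inf P → (∀ n → P n → f n ∈ xs) →
                   Σ X λ v → Inf (λ n → P n × f n ≡ v)
      pigeonhole f [] inf f∈ with () ← f∈ _ (proj₂ (proj₂ (inf 0)))
      pigeonhole f (x ∷ xs) {P} inf f∈ with inf⊎fin (λ n → P n × f n ≡ x)
      ... | inj₁ i = x , i
      ... | inj₂ (N , fin) with pigeonhole f xs (inf-≥ inf N) rest
        where
        rest : ∀ n → P n × N ≤ n → f n ∈ xs
        rest n (p , N≤n) with f∈ n p
        ... | here eq = ⊥-elim (fin n N≤n (p , eq))
        ... | there m = m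
      ... | v , i = v , λ M → let n , le , (p , _) , eq = i M in n , le , p , eq

    abstract
      -- If no value recurs infinitely often, then by `pigeonhole` no finite list contains all
      -- values of `f` on a tail of `P`, so `select` always finds a new one.
      const⊎injective : (f : ℕ → X) {P : ℕ → Set} → Inf P →
        (Σ X λ v → Inf (λ n → P n × f n ≡ v)) ⊎
        (Σ (ℕ → ℕ) λ φ → Incr φ × (∀ k → P (φ k)) × Bijective (f ∘ φ))
      const⊎injective f {P} inf with lem (Σ X λ v → Inf (λ n → P n × f n ≡ v))
      ... | yes c = inj₁ c
      ... | no ¬c = inj₂ result
        where
        W : ℕ → ℕ → X → Set
        W N m y = Σ ℕ λ n → N ≤ n × n < m × P n × y ≡ f n
        pick : ∀ N L → Σ ℕ λ m → Σ X λ y → W N m y × y ∉ L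
        pick N L = by-contra λ none → ¬c
          (let v , i = pigeonhole f L (inf-≥ inf N) (λ n (p , N≤n) → by-contra λ f∉ →
                         none (suc n , f n , (n , N≤n , n<1+n n , p , refl) , f∉))
           in v , λ M → let n , le , (p , _) , eq = i M in n , le , p , eq)
        result : Σ (ℕ → ℕ) λ φ → Incr φ × (∀ k → P (φ k)) × Bijective (f ∘ φ)
        result with select pick
        ... | g , b , w , b-inj =
          (λ k → proj₁ (w k))
          , (λ k → let _ , _ , lt , _ = w k ; _ , le , _ = w (suc k) in <-≤-trans lt le)
          , (λ k → let _ , _ , _ , p , _ = w k in p)
          , λ {i} {j} eq → b-inj (trans (eqᵇ i) (trans eq (sym (eqᵇ j))))
          where
          eqᵇ : ∀ k → b k ≡ f (proj₁ (w k))
          eqᵇ k = let _ , _ , _ , _ , e = w k in e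

    injective-avoids : {b : ℕ → X} → Bijective b → (L : List X) →
                       Σ ℕ λ N → ∀ n → N ≤ n → b n ∉ L
    injective-avoids {b} b-inj L with inf⊎fin (λ n → b n ∈ L)
    ... | inj₂ fin = fin
    ... | inj₁ inf =
      let v , i = pigeonhole b L inf (λ _ p → p)
          n , _ , _ , eq = i 0
          n′ , lt , _ , eq′ = i (suc n)
      in contradiction (b-inj (trans eq (sym eq′))) (<⇒≢ lt)

    -- The first half of Ramsey's theorem. The hypothesis `limit` replaces a finite set of colours,
    -- because `symmetric` applies this to products whose range is not known to be finite. A state
    -- is the infinite set of indices still available.
    module _ {f : ℕ → ℕ → X}
             (limit : ∀ i {P} → Inf P → (∀ n → P n → i < n) → Σ X λ v → Inf (λ n → P n × f i n ≡ v))
             where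

      private
        State : Set₁
        State = Σ (ℕ → Set) Inf

        head : State → ℕ
        head (P , inf) = proj₁ (inf 0)

        refine : (s : State) → Σ X λ v → Inf (λ n → (proj₁ s n × suc (head s) ≤ n) × f (head s) n ≡ v)
        refine s@(P , inf) = limit (head s) (inf-≥ inf (suc (head s))) (λ _ → proj₂)

        next : State → State
        next s = _ , proj₂ (refine s)

        φ : State → ℕ → ℕ
        φ s zero    = head s
        φ s (suc k) = φ (next s) k

        r : State → ℕ → X
        r s zero    = proj₁ (refine s)
        r s (suc k) = r (next s) k

        φ-∈ : (s : State) (k : ℕ) → proj₁ s (φ s k)
        φ-∈ (P , inf) zero = proj₂ (proj₂ (inf 0))
        φ-∈ s (suc k) = proj₁ (proj₁ (φ-∈ (next s) k))

        φ-incr : (s : State) → Incr (φ s)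
        φ-incr s zero    = proj₂ (proj₁ (φ-∈ (next s) 0))
        φ-incr s (suc n) = φ-incr (next s) n

        φ-hom : (s : State) {i j : ℕ} → i < j → f (φ s i) (φ s j) ≡ r s i
        φ-hom s {zero}  {suc j} _       = proj₂ (φ-∈ (next s) j)
        φ-hom s {suc i} {suc j} (s≤s p) = φ-hom (next s) p

      end-homogeneous : Σ (ℕ → ℕ) λ φ → Incr φ ×
        Σ (ℕ → X) λ r → ∀ {i j} → i < j → f (φ i) (φ j) ≡ r i
      end-homogeneous = φ s₀ , φ-incr s₀ , r s₀ , φ-hom s₀
        where
        s₀ : State
        s₀ = (λ n → 0 ≤ n) , λ N → N , ≤-refl , z≤n

    ramsey : {f : ℕ → ℕ → X} (xs : List X) → (∀ {i j} → i < j → f i j ∈ xs) →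
             Σ (ℕ → ℕ) λ φ → Incr φ × Σ X λ v → ∀ {i j} → i < j → f (φ i) (φ j) ≡ v
    ramsey {f} xs f∈ =
      let φ , φ↑ , r , hom = end-homogeneous {f = f} (λ i inf gt → pigeonhole (f i) xs inf (λ n p → f∈ (gt n p)))
          v , inf = pigeonhole r xs {λ n → 0 ≤ n} (λ N → N , ≤-refl , z≤n)
                      (λ n _ → subst (_∈ xs) (hom (n<1+n n)) (f∈ (φ↑ n)))
          ψ , ψ↑ , p = enumerate inf
      in φ ∘ ψ , incr-∘ φ↑ ψ↑ , v , λ {i} i<j → trans (hom (incr-< ψ↑ i<j)) (proj₂ (p i))

-- Finite sums and sumsequences

module Blocks {S : Set} (_∙_ : S → S → S) (assoc : (x y z : S) → (x ∙ y) ∙ z ≡ x ∙ (y ∙ z)) where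

  Seq : Set
  Seq = ℕ → S

  -- Sum a m n x : x is the sum a_F of some nonempty F ⊆ [m, n).
  data Sum (a : Seq) : ℕ → ℕ → S → Set where
    last : ∀ {m i n} → m ≤ i → i < n → Sum a m n (a i)
    cons : ∀ {m i n x} → m ≤ i → Sum a (suc i) n x → Sum a m n (a i ∙ x)

  sum⇒< : ∀ {a m n x} → Sum a m n x → m < n
  sum⇒< (last m≤i i<n) = ≤-<-trans m≤i i<n
  sum⇒< (cons m≤i p)   = <-trans (s≤s m≤i) (sum⇒< p)

  widenˡ : ∀ {a k m n x} → k ≤ m → Sum a m n x → Sum a k n x
  widenˡ k≤m (last m≤i i<n) = last (≤-trans k≤m m≤i) i<n
  widenˡ k≤m (cons m≤i p)   = cons (≤-trans k≤m m≤i) p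

  widenʳ : ∀ {a m n k x} → n ≤ k → Sum a m n x → Sum a m k x
  widenʳ n≤k (last m≤i i<n) = last m≤i (<-≤-trans i<n n≤k)
  widenʳ n≤k (cons m≤i p)   = cons m≤i (widenʳ n≤k p)

  append : ∀ {a m n k x y} → Sum a m n x → Sum a n k y → Sum a m k (x ∙ y)
  append (last m≤i i<n) q = cons m≤i (widenˡ i<n q)
  append (cons m≤i p) q   = subst (Sum _ _ _) (sym (assoc _ _ _)) (cons m≤i (append p q))

  shift : ∀ {a m n x} → Sum a (suc m) (suc n) x → Sum (a ∘ suc) m n x
  shift (last {i = suc i} (s≤s m≤i) (s≤s i<n)) = last m≤i i<n
  shift (cons {i = suc i} (s≤s m≤i) p)         = cons m≤i (shift p)

  drop : ℕ → Seq → Seq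
  drop n a k = a (n + k)

  Sums : Seq → ℕ → S → Set
  Sums a m x = Σ ℕ λ n → Sum a m n x

  sums-drop : ∀ n {a x} → Sums a n x → Sums (drop n a) 0 x
  sums-drop zero    p             = p
  sums-drop (suc n) (zero , p)    with () ← sum⇒< p
  sums-drop (suc n) (suc k , p)   = sums-drop n (k , shift p)

  infix 4 _⊑[_]_ _⊑_

  -- b is the sumsequence of a along the successive blocks [pos n, pos (n + 1)), all beyond m.
  record _⊑[_]_ (b : Seq) (m : ℕ) (a : Seq) : Set where
    constructor blocks
    field
      pos  : ℕ → ℕ
      from : m ≤ pos 0
      sums : ∀ n → Sum a (pos n) (pos (suc n)) (b n)

  _⊑_ : Seq → Seq → Set
  b ⊑ a = b ⊑[ 0 ] a

  open _⊑[_]_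

  pos-mono : ∀ {a b m} (p : b ⊑[ m ] a) {i j} → i ≤ j → pos p i ≤ pos p j
  pos-mono p {i} {j} i≤j with m≤n⇒m<n∨m≡n i≤j
  ... | inj₂ refl = ≤-refl
  ... | inj₁ (s≤s i≤j-1) = ≤-trans (pos-mono p i≤j-1) (<⇒≤ (sum⇒< (sums p _)))

  from-≤ : ∀ {a b m} (p : b ⊑[ m ] a) n → m ≤ pos p n
  from-≤ p n = ≤-trans (from p) (pos-mono p z≤n)

  ⊑-sum : ∀ {a b m} (p : b ⊑[ m ] a) {i j x} → Sum b i j x → Sum a (pos p i) (pos p j) x
  ⊑-sum p (last m≤i i<n) = widenˡ (pos-mono p m≤i) (widenʳ (pos-mono p i<n) (sums p _))
  ⊑-sum p (cons m≤i q)   = widenˡ (pos-mono p m≤i) (append (sums p _) (⊑-sum p q))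

  ⊑-sums : ∀ {a b m k x} → b ⊑[ m ] a → Sums b k x → Sums a m x
  ⊑-sums p (n , q) = pos p n , widenˡ (from-≤ p _) (⊑-sum p q)

  term : ∀ {a} n → Sums a n (a n)
  term n = suc n , last ≤-refl ≤-refl

  ⊑-weaken : ∀ {a b m k} → k ≤ m → b ⊑[ m ] a → b ⊑[ k ] a
  ⊑-weaken k≤m (blocks g f s) = blocks g (≤-trans k≤m f) s

  ⊑-trans-pos : ∀ {a b c m k} → c ⊑[ k ] b → (p : b ⊑[ m ] a) → c ⊑[ pos p k ] a
  ⊑-trans-pos q p = blocks (pos p ∘ pos q) (pos-mono p (from q)) (λ n → ⊑-sum p (sums q n))

  ⊑-trans : ∀ {a b c m k} → c ⊑[ k ] b → b ⊑[ m ] a → c ⊑[ m ] a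
  ⊑-trans q p = ⊑-weaken (from-≤ p _) (⊑-trans-pos q p)

  subseq-⊑ : ∀ {a φ} → Incr φ → a ∘ φ ⊑[ φ 0 ] a
  subseq-⊑ {φ = φ} φ↑ = blocks φ ≤-refl (λ n → last ≤-refl (φ↑ n))

  drop-⊑ : ∀ {a} n → drop n a ⊑[ n ] a
  drop-⊑ n = ⊑-weaken (m≤m+n n 0) (subseq-⊑ (incr-+ n))

  ⊑-refl : ∀ {a} → a ⊑ a
  ⊑-refl = drop-⊑ 0

  sum-inv : ∀ {a n x} → Sum a 0 (suc n) x →
            x ≡ a 0 ⊎ Sum (a ∘ suc) 0 n x ⊎ Σ S λ y → Sum (a ∘ suc) 0 n y × x ≡ a 0 ∙ y
  sum-inv (last {i = zero} _ _)         = inj₁ refl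
  sum-inv (last {i = suc i} _ (s≤s lt)) = inj₂ (inj₁ (last z≤n lt))
  sum-inv (cons {i = zero} _ p)         = inj₂ (inj₂ (_ , shift p , refl))
  sum-inv (cons {i = suc i} _ p)        = inj₂ (inj₁ (cons z≤n (shift p)))

  -- Translation between `Sum` and sums over finite sets

  module _ {a : Seq} where

    sumF⇒sum : ∀ F → Sum a (minimum F) (suc (maximum F)) (sumF _∙_ a F)
    sumF⇒sum (fset (_ ∷ _) linked) = go linked
      where
      go : ∀ {i l} → Linked _<_ (i ∷ l) →
           Sum a i (suc (lastOf i l)) (foldr₁ _∙_ (Data.List.NonEmpty.map a (i ∷ l)))
      go [-]       = last ≤-refl ≤-refl
      go (i<j ∷ p) = cons ≤-refl (widenˡ i<j (go p))

    sum⇒sumF : ∀ {m n x} → Sum a m n x →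
               Σ FinSet λ F → sumF _∙_ a F ≡ x × (∀ {i} → i ∈ toList (elems F) → m ≤ i × i < n)
    sum⇒sumF (last {i = i} m≤i i<n) = fset (i ∷ []) [-] , refl , λ { (here refl) → m≤i , i<n }
    sum⇒sumF (cons {i = i} m≤i p) with sum⇒sumF p
    ... | fset (j ∷ l) linked , refl , bound =
      fset (i ∷ j ∷ l) (proj₁ (bound (here refl)) ∷ linked) , refl , λ where
        (here refl) → m≤i , sum⇒< (widenˡ (n≤1+n _) p)
        (there k∈)  → let lo , hi = bound k∈ in ≤-trans m≤i (<⇒≤ lo) , hi

    FS⇒sums : ∀ {x} → FS _∙_ a x → Sums a 0 x
    FS⇒sums (F , refl) = _ , widenˡ z≤n (sumF⇒sum F)

    sums⇒FS : ∀ {x} → Sums a 0 x → FS _∙_ a x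
    sums⇒FS (_ , p) = let F , eq , _ = sum⇒sumF p in F , eq

    ⊑⇒sumsequence : ∀ {b} → b ⊑ a → Sumsequence _∙_ a b
    ⊑⇒sumsequence p = (λ n → proj₁ (F n))
      , (λ n i∈ j∈ → <-≤-trans (proj₂ (proj₂ (proj₂ (F n)) i∈)) (proj₁ (proj₂ (proj₂ (F (suc n))) j∈)))
      , λ n → sym (proj₁ (proj₂ (F n)))
      where F = λ n → sum⇒sumF (sums p n)

    sumsequence⇒⊑ : ∀ {b} → Sumsequence _∙_ a b → b ⊑ a
    sumsequence⇒⊑ (F , F≺ , eq) = blocks (minimum ∘ F) z≤n λ n →
      subst (Sum a _ _) (sym (eq n))
        (widenʳ (F≺ n (maximum-∈ (F n)) (minimum-∈ (F (suc n)))) (sumF⇒sum (F n)))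

    -- Properness with a cut `n` in place of the pair of finite sets; in this form it passes to
    -- sumsequences by `⊑-sum`.
    Separated : Set
    Separated = ∀ {n x} → Sum a 0 n x → ¬ Sums a n x

    separated⇒proper : Separated → Proper _∙_ a
    separated⇒proper sep F₁ F₂ F₁≺F₂ eq =
      sep (widenˡ z≤n (sumF⇒sum F₁))
          (_ , subst (Sum a _ _) (sym eq) (widenˡ (F₁≺F₂ (maximum-∈ F₁) (minimum-∈ F₂)) (sumF⇒sum F₂)))

    proper⇒separated : Proper _∙_ a → Separated
    proper⇒separated pr p (_ , q) =
      let F₁ , eq₁ , b₁ = sum⇒sumF p ; F₂ , eq₂ , b₂ = sum⇒sumF q
      in pr F₁ F₂ (λ i∈ j∈ → <-≤-trans (proj₂ (b₁ i∈)) (proj₁ (b₂ j∈))) (trans eq₁ (sym eq₂))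

  proper⇒injective : ∀ {a} → Proper _∙_ a → Bijective a
  proper⇒injective pr = ≢⇒injective λ {i} {j} i<j eq →
    proper⇒separated pr {j} (last z≤n i<j) (suc j , subst (Sum _ _ _) (sym eq) (last ≤-refl ≤-refl))

  ⊑-separated : ∀ {a b} → b ⊑ a → Separated {a} → Separated {b}
  ⊑-separated p sep u (_ , v) = sep (widenˡ z≤n (⊑-sum p u)) (_ , ⊑-sum p v)

  -- Diagonalisation over nested sumsequences: each step takes a sum of the first `m` terms of the
  -- current sequence and continues with a sumsequence of the rest. The level `ℓ` is free since the
  -- states in Hindman's theorem contain predicates.
  module Fusion {ℓ} {State : Set ℓ} (seq : State → Seq)
    (step : (s : State) → Σ ℕ λ m → Σ S λ x → Σ State λ s′ → Sum (seq s) 0 m x × seq s′ ⊑[ m ] seq s)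
    where

    head : State → S
    head s = proj₁ (proj₂ (step s))

    next : State → State
    next s = proj₁ (proj₂ (proj₂ (step s)))

    run : State → Seq
    run s zero    = head s
    run s (suc n) = run (next s) n

    state : State → ℕ → State
    state s zero    = s
    state s (suc n) = state (next s) n

    private
      next-⊑ : ∀ s → seq (next s) ⊑[ proj₁ (step s) ] seq s
      next-⊑ s = proj₂ (proj₂ (proj₂ (proj₂ (step s))))

      position : State → ℕ → ℕ
      position s zero    = 0
      -- The boundary is pulled back through one `next-⊑` per step, so it is a position in the
      -- initial sequence.
      position s (suc n) = pos (next-⊑ s) (position (next s) n)

      run-sum : ∀ s n → Sum (seq s) (position s n) (position s (suc n)) (run s n)
      run-sum s zero    = widenʳ (from (next-⊑ s)) (proj₁ (proj₂ (proj₂ (proj₂ (step s)))))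
      run-sum s (suc n) = ⊑-sum (next-⊑ s) (run-sum (next s) n)

    run-⊑ : ∀ s → run s ⊑ seq s
    run-⊑ s = blocks (position s) z≤n (run-sum s)

    drop-run-⊑ : ∀ n s → drop n (run s) ⊑ seq (state s n)
    drop-run-⊑ zero    s = run-⊑ s
    drop-run-⊑ (suc n) s = drop-run-⊑ n (next s)

  -- The update of the list of all finite sums when the term `x` is appended. It is added on the
  -- right only, being the latest term.
  extend : List S → S → List S
  extend L x = x ∷ L ++ map (_∙ x) L

  extend-old : ∀ {L x l} → l ∈ L → l ∈ extend L x
  extend-old l∈ = there (∈-++⁺ˡ l∈)

  extend-sum : ∀ {L x l} → l ∈ L → l ∙ x ∈ extend L x
  extend-sum {L} {x} l∈ = there (∈-++⁺ʳ L (∈-map⁺ (_∙ x) l∈))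

  extend-elim : ∀ {p} {L x} (P : S → Set p) → P x → (∀ {l} → l ∈ L → P l) → (∀ {l} → l ∈ L → P (l ∙ x)) →
                ∀ {y} → y ∈ extend L x → P y
  extend-elim P px pl pl+x (here refl) = px
  extend-elim {L = L} {x} P px pl pl+x (there y∈) with ∈-++⁻ L y∈
  ... | inj₁ l∈ = pl l∈
  ... | inj₂ m∈ with ∈-map⁻ (_∙ x) m∈
  ... | _ , l∈ , refl = pl+x l∈

  -- Greedy construction of a sumsequence c: L collects the finite sums of the terms chosen so far,
  -- and the remaining terms are sums of b.
  module Build {R : List S → S → Set} {Inv : List S → Seq → Set}
    (grow : ∀ {L b} → Inv L b → Σ ℕ λ m → Σ S λ x → Σ Seq λ b′ →
            R L x × Sum b 0 m x × b′ ⊑[ m ] b × Inv (extend L x) b′)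
    where

    private
      State : Set
      State = Σ (List S) λ L → Σ Seq λ b → Inv L b

      seq : State → Seq
      seq (_ , b , _) = b

      step : (s : State) → Σ ℕ λ m → Σ S λ x → Σ State λ s′ → Sum (seq s) 0 m x × seq s′ ⊑[ m ] seq s
      step (L , b , inv) =
        let m , x , b′ , _ , p , q , inv′ = grow inv in m , x , (extend L x , b′ , inv′) , p , q

      open Fusion seq step

      -- Only the first claim is wanted. The recursion moves the initial state, so the induction
      -- must also follow the sums `l ∙ x` that begin with an element of the initial list.
      collected : ∀ n s →
        (∀ {x} → Sum (run s) 0 n x → x ∈ proj₁ (state s n)) ×
        (∀ {l} → l ∈ proj₁ s → l ∈ proj₁ (state s n)) ×
        (∀ {l x} → l ∈ proj₁ s → Sum (run s) 0 n x → l ∙ x ∈ proj₁ (state s n))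
      collected zero s = (λ p → contradiction (sum⇒< p) λ ()) , id
                       , (λ _ p → contradiction (sum⇒< p) λ ())
      collected (suc n) s = sums∈ , (λ l∈ → old (extend-old l∈)) , shifted
        where
        IH = collected n (next s)
        old : ∀ {l} → l ∈ proj₁ (next s) → l ∈ proj₁ (state (next s) n)
        old = proj₁ (proj₂ IH)
        sums∈ : ∀ {x} → Sum (run s) 0 (suc n) x → x ∈ proj₁ (state s (suc n))
        sums∈ p with sum-inv p
        ... | inj₁ refl                = old (here refl)
        ... | inj₂ (inj₁ q)            = proj₁ IH q
        ... | inj₂ (inj₂ (_ , q , refl)) = proj₂ (proj₂ IH) (here refl) q
        shifted : ∀ {l x} → l ∈ proj₁ s → Sum (run s) 0 (suc n) x → l ∙ x ∈ proj₁ (state s (suc n))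
        shifted l∈ p with sum-inv p
        ... | inj₁ refl     = old (extend-sum l∈)
        ... | inj₂ (inj₁ q) = proj₂ (proj₂ IH) (extend-old l∈) q
        ... | inj₂ (inj₂ (_ , q , refl)) =
          subst (_∈ proj₁ (state (next s) n)) (assoc _ _ _) (proj₂ (proj₂ IH) (extend-sum l∈) q)

      allowed : ∀ n s → R (proj₁ (state s n)) (run s n)
      allowed zero (L , b , inv) = let _ , _ , _ , r , _ = grow inv in r
      allowed (suc n) s = allowed n (next s)

    abstract
      build : ∀ {b} → Inv [] b → Σ Seq λ c → c ⊑ b × ∀ n → Σ (List S) λ L → Σ Seq λ b′ →
              Inv L b′ × R L (c n) × (∀ {x} → Sum c 0 n x → x ∈ L) × drop n c ⊑ b′
      build inv = run s , run-⊑ s , λ n →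
        _ , _ , proj₂ (proj₂ (state s n)) , allowed n s , proj₁ (collected n s) , drop-run-⊑ n s
        where
        s : State
        s = [] , _ , inv

  build-injective : ∀ {c : Seq} → (∀ n → Σ (List S) λ L → c n ∉ L × (∀ {x} → Sum c 0 n x → x ∈ L)) →
                    Bijective c
  build-injective fresh = ≢⇒injective λ {i} {j} i<j eq →
    let L , ∉L , sums∈ = fresh j in ∉L (subst (_∈ L) eq (sums∈ (last z≤n i<j)))

-- Hindman's theorem and the implications (2) ⇒ (5) ⇒ (4) ⇒ (1) ⇒ (3)

module Implications {S : Set} (_∙_ : S → S → S) (assoc : (x y z : S) → (x ∙ y) ∙ z ≡ x ∙ (y ∙ z))
            (em : ExcludedMiddle (Level.suc 0ℓ)) where

  open Classical em
  open Blocks _∙_ assoc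
  open _⊑[_]_

  -- Baumgartner's notion of largeness, with sumsequences in the role of his families of disjoint
  -- finite sets.
  Large : (S → Set) → Seq → Set
  Large C b = ∀ {b′} → b′ ⊑ b → Σ S λ x → Sums b′ 0 x × C x

  large-⊑ : ∀ {C b b′ m} → b′ ⊑[ m ] b → Large C b → Large C b′
  large-⊑ p large q = large (⊑-weaken z≤n (⊑-trans q p))

  -- If the piece of `e` is not large, some sumsequence `b₁` has no sum in it. The remaining pieces
  -- then cover the sums of `b₁` in `C`, and the induction continues there.
  large-split : {X : Set} (E : List X) (Q : X → S → Set) {C : S → Set} {b : Seq} → Large C b →
                (∀ {x} → Sums b 0 x → C x → Σ X λ e → e ∈ E × Q e x) →
                Σ X λ e → e ∈ E × Σ Seq λ b′ → b′ ⊑ b × Large (λ x → C x × Q e x) b′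
  large-split [] Q large cover with large ⊑-refl
  ... | x , s , c with () ← proj₁ (proj₂ (cover s c))
  large-split (e ∷ E) Q {C} {b} large cover with lem (Large (λ x → C x × Q e x) b)
  ... | yes l = e , here refl , b , ⊑-refl , l
  ... | no ¬l =
    let b₁ , p , none = small
        e′ , e′∈ , b′ , q , l = large-split E Q (large-⊑ p large) λ s c →
          let e′ , e′∈ , h = cover (⊑-sums p s) c in e′ , later none s c e′∈ h , h
    in e′ , there e′∈ , b′ , ⊑-trans q p , l
    where
    small : Σ Seq λ b₁ → b₁ ⊑ b × ∀ x → Sums b₁ 0 x → ¬ (C x × Q e x)
    small = by-contra λ no-b₁ → ¬l λ {b₁} p → by-contra λ no-x →
              no-b₁ (b₁ , p , λ x s c → no-x (x , s , c))
    later : ∀ {b₁ x e′} → (∀ x → Sums b₁ 0 x → ¬ (C x × Q e x)) → Sums b₁ 0 x → C x →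
            e′ ∈ e ∷ E → Q e′ x → e′ ∈ E
    later none s c (here refl) h = ⊥-elim (none _ s (c , h))
    later none s c (there m)   h = m

  -- The bounds by `m` are those required of one step of `Fusion`: `e` is a sum of terms before `m`,
  -- and the sequence continues beyond `m`.
  FinitelyCovered : (S → Set) → Seq → Set
  FinitelyCovered C b =
    Σ (List S) λ E → Σ ℕ λ m → Σ Seq λ b′ → (∀ {e} → e ∈ E → Sum b 0 m e) ×
    b′ ⊑[ m ] b × ∀ {d} → Sums b′ 0 d → Σ S λ e → e ∈ E × C (e ∙ d)

  -- Otherwise there is c ⊑ b such that no sum of two or more terms of c lies in C.
  large-cover : ∀ {C b} → Large C b → FinitelyCovered C b
  large-cover {C} {b} large = by-contra absurd
    where
    module _ (none : ¬ FinitelyCovered C b) where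
      R : List S → S → Set
      R L x = ∀ {l} → l ∈ L → ¬ C (l ∙ x)

      Inv : List S → Seq → Set
      Inv L b′ = Σ ℕ λ m → b′ ⊑[ m ] b × ∀ {l} → l ∈ L → Sum b 0 m l

      grow : ∀ {L b′} → Inv L b′ → Σ ℕ λ m → Σ S λ x → Σ Seq λ b″ →
             R L x × Sum b′ 0 m x × b″ ⊑[ m ] b′ × Inv (extend L x) b″
      grow {L} {b′} (m , p , L-sum) =
        let d , (k , s) , bad = uncovered
        in k , d , drop k b′ , bad , s , drop-⊑ k
         , pos p k , ⊑-trans-pos (drop-⊑ k) p
         , extend-elim (Sum b 0 (pos p k)) (widenˡ z≤n (⊑-sum p s))
             (λ l∈ → widenʳ (from-≤ p k) (L-sum l∈))
             (λ l∈ → append (L-sum l∈) (widenˡ (from p) (⊑-sum p s)))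
        where
        uncovered : Σ S λ d → Sums b′ 0 d × R L d
        uncovered = by-contra λ no-d → none (L , m , b′ , L-sum , p , λ {d} s → by-contra λ no-e →
                      no-d (d , s , λ {l} l∈ c → no-e (l , l∈ , c)))

      open Build {R} {Inv} grow

      absurd : ⊥
      absurd with build {b} (0 , ⊑-refl , λ ())
      ... | c , c⊑b , at = let y , (_ , s) , cy = large (⊑-trans pairs-⊑ c⊑b) in pairs-avoid s cy
        where
        avoid : ∀ {m n z} → Sum c m n z → ∀ {l} → Sum c 0 m l → ¬ C (l ∙ z)
        avoid (last {i = i} m≤i _) u = let _ , _ , _ , bad , collect , _ = at i in bad (collect (widenʳ m≤i u))
        avoid (cons m≤i p) u = subst (λ y → ¬ C y) (assoc _ _ _) (avoid p (append u (last m≤i ≤-refl)))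

        double : ℕ → ℕ
        double zero    = 0
        double (suc n) = suc (suc (double n))

        pairs : Seq
        pairs n = c (double n) ∙ c (suc (double n))

        pairs-⊑ : pairs ⊑ c
        pairs-⊑ = blocks double z≤n λ n → cons ≤-refl (last ≤-refl ≤-refl)

        pairs-avoid : ∀ {m n y} → Sum pairs m n y → ¬ C y
        pairs-avoid (last _ _)   = avoid (last ≤-refl ≤-refl) (last z≤n ≤-refl)
        pairs-avoid (cons _ p) = subst (λ y → ¬ C y) (sym (assoc _ _ _))
                                   (avoid (cons ≤-refl (⊑-sum pairs-⊑ p)) (last z≤n ≤-refl))

  -- The finitely many conditions `C (e ∙ x)` given by `large-cover` cover all sums of a tail
  -- sequence, so `large-split` makes one of them large together with `C`.
  large-translate : ∀ {C b} → Large C b → Σ ℕ λ m → Σ S λ e → Σ Seq λ b′ →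
                    Sum b 0 m e × b′ ⊑[ m ] b × Large (λ x → C x × C (e ∙ x)) b′
  large-translate {C} large =
    let E , m , b′ , E-sum , p , cover = large-cover large
        e , e∈ , b″ , q , l = large-split E (λ e x → C (e ∙ x)) (large-⊑ p large) (λ s _ → cover s)
    in m , e , b″ , E-sum e∈ , ⊑-trans q p , l

  -- Iterating `large-translate` gives elements `e n` and decreasing large sets `P n` such that
  -- adding `e n` on the left maps `P (suc n)` into `P n`. The `e n` themselves need not lie in `C`;
  -- so largeness is used again, to pick from each tail of `e` a sum lying in the corresponding
  -- `P N`. By `translate`, all sums of these elements stay in `P 0`, which is `C`.
  large⇒sums : ∀ {C b} → Large C b → Σ Seq λ c → c ⊑ b × ∀ {x} → Sums c 0 x → C x
  large⇒sums {C} {b} large = c , ⊑-trans c⊑e (run-⊑ s₀) , λ (_ , p) → antitone {n = N 0} z≤n (c-sums p)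
    where
    State : Set₁
    State = Σ (S → Set) λ C → Σ Seq (Large C)

    seq : State → Seq
    seq (_ , b , _) = b

    step : (s : State) → Σ ℕ λ m → Σ S λ x → Σ State λ s′ → Sum (seq s) 0 m x × seq s′ ⊑[ m ] seq s
    step (C , b , l) = let m , e , b′ , s , p , l′ = large-translate l in m , e , (_ , b′ , l′) , s , p

    open Fusion seq step

    s₀ : State
    s₀ = C , b , large

    e : Seq
    e = run s₀

    P : ℕ → S → Set
    P n = proj₁ (state s₀ n)

    P-suc : ∀ {n x} → P (suc n) x → P n x × P n (e n ∙ x)
    P-suc {n} = go n s₀
      where
      go : ∀ n s {x} → proj₁ (state s (suc n)) x →
           proj₁ (state s n) x × proj₁ (state s n) (run s n ∙ x)
      go zero    s = id
      go (suc n) s = go n (next s)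

    antitone : ∀ {m n x} → m ≤ n → P n x → P m x
    antitone {m} {n} m≤n p with m≤n⇒m<n∨m≡n m≤n
    ... | inj₂ refl = p
    antitone {m} {suc n} _ p | inj₁ (s≤s m≤n) = antitone m≤n (proj₁ (P-suc {n} p))

    translate : ∀ {m n x y} → Sum e m n y → P n x → P m (y ∙ x)
    translate (last {i = i} m≤i i<n) px = antitone m≤i (proj₂ (P-suc {i} (antitone i<n px)))
    translate {m} (cons {i = i} m≤i p) px =
      subst (P m) (sym (assoc _ _ _)) (antitone m≤i (proj₂ (P-suc {i} (translate p px))))

    late : ∀ N → Σ ℕ λ k → Σ S λ y → Sum e N k y × P N y
    late N = let y , s , py = proj₂ (proj₂ (state s₀ N)) (drop-run-⊑ N s₀)
                 k , q = ⊑-sums (drop-⊑ N) s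
             in k , y , q , py

    N : ℕ → ℕ
    N zero    = 0
    N (suc k) = proj₁ (late (N k))

    c : Seq
    c k = proj₁ (proj₂ (late (N k)))

    c⊑e : c ⊑ e
    c⊑e = blocks N z≤n λ k → proj₁ (proj₂ (proj₂ (late (N k))))

    c-sums : ∀ {m n z} → Sum c m n z → P (N m) z
    c-sums (last {i = i} m≤i _) = antitone (pos-mono c⊑e m≤i) (proj₂ (proj₂ (proj₂ (late (N i)))))
    c-sums (cons {i = i} m≤i p) = antitone (pos-mono c⊑e m≤i) (translate (sums c⊑e i) (c-sums p))

  hindman : ∀ {k} (χ : S → Fin k) (b : Seq) → Σ Seq λ c → c ⊑ b × Monochromatic _∙_ χ (FS _∙_ c)
  hindman {k} χ b =
    -- The full predicate is trivially large, and the colour classes split it.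
    let i , _ , b′ , p , l = large-split (allFin k) (λ i x → χ x ≡ i) {λ _ → ⊤} {b}
                               (λ {b′} _ → b′ 0 , term 0 , tt) (λ {x} _ _ → χ x , ∈-allFin (χ x) , refl)
        c , q , mono = large⇒sums l
    in c , ⊑-trans q p , i , λ x s → proj₂ (mono (FS⇒sums s))

  -- The five assertions and the implications leading from (2) to (3)

  C1 : Set₁
  C1 = ∀ (A : S → Set) (k : ℕ) (c : S → Fin k) → ProperIP _∙_ A →
       Σ (Fin k) λ i → ProperIP _∙_ (λ x → A x × c x ≡ i)

  C2 : Set
  C2 = ∀ (a : ℕ → S) → Bijective a → Σ (ℕ → S) λ b → Sumsequence _∙_ a b × Proper _∙_ b

  C3 : Set₁
  C3 = (¬ (Σ (S → Set) λ T → IsSubsemigroup _∙_ T × InfiniteP T × FiniteP (_⊕_ _∙_ T T)))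
       × (¬ Embeds _∙_ fan) × (¬ Embeds _∙_ _⊞_)

  C4 : Set
  C4 = ∀ (a : ℕ → S) → Bijective a → (k : ℕ) (c : S → Fin k) →
       Σ (ℕ → S) λ b → Sumsequence _∙_ a b × Bijective b × Monochromatic _∙_ c (FS _∙_ b)

  C5 : Set
  C5 = ∀ (a : ℕ → S) → Bijective a → (k : ℕ) (c : S → Fin k) →
       Σ (ℕ → S) λ b → Sumsequence _∙_ a b × Proper _∙_ b × Monochromatic _∙_ c (FS _∙_ b)

  2⇒5 : C2 → C5
  2⇒5 c2 a a-inj k χ =
    let b , b⊑a , proper = c2 a a-inj
        c , c⊑b , mono = hindman χ b
    in c , ⊑⇒sumsequence (⊑-trans c⊑b (sumsequence⇒⊑ b⊑a))
     , separated⇒proper (⊑-separated c⊑b (proper⇒separated proper)) , mono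

  5⇒4 : C5 → C4
  5⇒4 c5 a a-inj k χ =
    let b , b⊑a , proper , mono = c5 a a-inj k χ in b , b⊑a , proper⇒injective proper , mono

  4⇒1 : C4 → C1
  4⇒1 c4 A k χ (a , a-inj , FS⊆A) =
    let b , b⊑a , b-inj , i , mono = c4 a a-inj k χ
    in i , b , b-inj , λ x s → FS⊆A x (sums⇒FS (⊑-sums (sumsequence⇒⊑ b⊑a) (FS⇒sums s))) , mono x s

  indicator : List S → S → Fin 2
  indicator xs x with lem (x ∈ xs)
  ... | yes _ = zero
  ... | no  _ = suc zero

  indicator-∈ : ∀ {xs x} → indicator xs x ≡ zero → x ∈ xs
  indicator-∈ {xs} {x} eq with lem (x ∈ xs)
  ... | yes x∈ = x∈
  indicator-∈ () | no _

  indicator-∉ : ∀ {xs x} → indicator xs x ≡ suc zero → x ∉ xs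
  indicator-∉ {xs} {x} eq with lem (x ∈ xs)
  ... | no x∉ = x∉
  indicator-∉ () | yes _

  -- The part of `A` in `xs` is finite and contains no injective sequence. A proper IP set in the
  -- other part would contain `b 0 ∙ b 1`, which lies in `xs`.
  finite-sums⇒¬1 : ∀ {A a} (xs : List S) → Bijective a → (∀ {x} → Sums a 0 x → A x) →
                   (∀ {x y} → A x → A y → x ≢ y → x ∙ y ∈ xs) → ¬ C1
  finite-sums⇒¬1 {A} {a} xs a-inj Sums⊆A sum∈ c1
    with c1 A 2 (indicator xs) (a , a-inj , λ x s → Sums⊆A (FS⇒sums s))
  ... | zero , b , b-inj , colour =
    let N , avoids = injective-avoids b-inj xs
    in avoids N ≤-refl (indicator-∈ (proj₂ (colour _ (sums⇒FS (N + 1 , last z≤n (m<m+n N (s≤s z≤n)))))))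
  ... | suc zero , b , b-inj , colour =
    indicator-∉ (proj₂ (colour _ (sums⇒FS (2 , cons z≤n (last ≤-refl ≤-refl)))))
      (sum∈ (A-term 0) (A-term 1) λ eq → contradiction (b-inj eq) λ ())
    where
    A-term : ∀ n → A (b n)
    A-term n = proj₁ (colour _ (sums⇒FS (suc n , last z≤n ≤-refl)))

  1⇒3 : C1 → C3
  1⇒3 c1 = ¬finite , ¬fan , ¬C
    where
    ¬finite : ¬ (Σ (S → Set) λ T → IsSubsemigroup _∙_ T × InfiniteP T × FiniteP (_⊕_ _∙_ T T))
    ¬finite (T , sub , inf , xs , T⊕T⊆xs) =
      finite-sums⇒¬1 {T} xs (proj₂ (proj₂ (proj₂ selected))) (λ (_ , p) → sums∈T p)
        (λ Tx Ty _ → T⊕T⊆xs _ (_ , _ , Tx , Ty , refl)) c1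
      where
      fresh : ∀ (L : List S) → Σ S λ y → T y × y ∉ L
      fresh L = by-contra λ none → inf (L , λ x Tx → by-contra λ x∉ → none (x , Tx , x∉))
      selected = select {W = λ _ _ → T} λ _ L → 0 , fresh L
      sums∈T : ∀ {m n x} → Sum (proj₁ (proj₂ selected)) m n x → T x
      sums∈T (last {i = i} _ _) = proj₁ (proj₂ (proj₂ selected)) i
      sums∈T (cons {i = i} _ p) = sub _ _ (proj₁ (proj₂ (proj₂ selected)) i) (sums∈T p)

    ¬fan : ¬ Embeds _∙_ fan
    ¬fan (f , f-inj , f-hom) = finite-sums⇒¬1 {Image} (f 0 ∷ []) f-inj (λ (_ , p) → sums∈ p) sum≡f0 c1
      where
      Image : S → Set
      Image x = Σ ℕ λ n → x ≡ f n
      sums∈ : ∀ {m n x} → Sum f m n x → Image x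
      sums∈ (last _ _) = _ , refl
      sums∈ (cons _ p) with sums∈ p
      ... | n , refl = _ , sym (f-hom _ n)
      sum≡f0 : ∀ {x y} → Image x → Image y → x ≢ y → x ∙ y ∈ f 0 ∷ []
      sum≡f0 (m , refl) (n , refl) ne with m ≟ n | f-hom m n
      ... | yes refl | _  = contradiction refl ne
      ... | no _     | eq = here (sym eq)

    ¬C : ¬ Embeds _∙_ _⊞_
    ¬C (f , f-inj , f-hom) = finite-sums⇒¬1 {A} (f zeroC ∷ []) a-inj A-sums sum≡0 c1
      where
      a : Seq
      a m = f (pair m 0)
      a-inj : Bijective a
      a-inj eq with f-inj eq
      ... | refl = refl
      -- Only one element of each row and zero are taken: distinct elements of the same row have
      -- nonzero sums.
      A : S → Set
      A x = (Σ ℕ λ m → x ≡ a m) ⊎ x ≡ f zeroC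
      sum-distinct : ∀ {m n} → m ≢ n → a m ∙ a n ≡ f zeroC
      sum-distinct {m} {n} ne with m ≟ n | f-hom (pair m 0) (pair n 0)
      ... | yes eq | _  = contradiction eq ne
      ... | no _   | eq = sym eq
      sums∈ : ∀ {m n x} → Sum a m n x → (Σ ℕ λ i → m ≤ i × x ≡ a i) ⊎ x ≡ f zeroC
      sums∈ (last m≤i _) = inj₁ (_ , m≤i , refl)
      sums∈ (cons {i = i} _ p) with sums∈ p
      ... | inj₁ (j , i<j , refl) = inj₂ (sum-distinct (<⇒≢ i<j))
      ... | inj₂ refl = inj₂ (sym (f-hom (pair i 0) zeroC))
      A-sums : ∀ {x} → Sums a 0 x → A x
      A-sums (_ , p) with sums∈ p
      ... | inj₁ (i , _ , eq) = inj₁ (i , eq)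
      ... | inj₂ eq = inj₂ eq
      sum≡0 : ∀ {x y} → A x → A y → x ≢ y → x ∙ y ∈ f zeroC ∷ []
      sum≡0 (inj₁ (m , refl)) (inj₁ (n , refl)) ne = here (sum-distinct λ { refl → ne refl })
      sum≡0 (inj₁ (m , refl)) (inj₂ refl) _ = here (sym (f-hom (pair m 0) zeroC))
      sum≡0 (inj₂ refl) (inj₁ (n , refl)) _ = here (sym (f-hom zeroC (pair n 0)))
      sum≡0 (inj₂ refl) (inj₂ refl) _ = here (sym (f-hom zeroC zeroC))

-- Unavoidable sums

module Unavoidability {S : Set} (_∙_ : S → S → S) (assoc : (x y z : S) → (x ∙ y) ∙ z ≡ x ∙ (y ∙ z))
            (em : ExcludedMiddle (Level.suc 0ℓ)) where

  open Classical em
  open Blocks _∙_ assoc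
  open _⊑[_]_

  drop-injective : ∀ {b} n → Bijective b → Bijective (drop n b)
  drop-injective n b-inj = bijective-∘ b-inj (incr-+ n)

  Unavoidable : Seq → S → Set
  Unavoidable b s = ∀ {b′} → b′ ⊑ b → Bijective b′ → Sums b′ 0 s

  unavoidable-⊑ : ∀ {b b′ m s} → b′ ⊑[ m ] b → Unavoidable b s → Unavoidable b′ s
  unavoidable-⊑ p u q = u (⊑-trans q (⊑-weaken z≤n p))

  recurs : ∀ {b s} → Bijective b → Unavoidable b s → ∀ N → Sums b N s
  recurs b-inj u N = ⊑-sums (drop-⊑ N) (u (⊑-weaken z≤n (drop-⊑ N)) (drop-injective N b-inj))

  separated-sumsequence : ∀ {a} → Bijective a →
    (∀ {b s} → b ⊑ a → Bijective b → ¬ Unavoidable b s) → Σ Seq λ c → c ⊑ a × Separated {c}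
  separated-sumsequence {a} a-inj none =
    let c , c⊑a , at = build {a} (⊑-refl , a-inj , λ ()) in c , c⊑a , λ {n} p q →
      let _ , _ , (_ , _ , avoids) , _ , collect , d⊑b = at n
      in avoids (collect p) (⊑-sums d⊑b (sums-drop n q))
    where
    Avoiding : List S → Seq → Set
    Avoiding L b = Σ Seq λ b′ → b′ ⊑ b × Bijective b′ × ∀ {s} → s ∈ L → ¬ Sums b′ 0 s

    avoid₁ : ∀ {b} s → b ⊑ a → Bijective b → Avoiding (s ∷ []) b
    avoid₁ {b} s p b-inj = by-contra {Avoiding (s ∷ []) b} λ no-b′ → none {s = s} p b-inj λ {b′} q b′-inj →
      by-contra λ ¬s → no-b′ (b′ , q , b′-inj , λ { (here refl) → ¬s })

    avoid : ∀ L {b} → b ⊑ a → Bijective b → Avoiding L b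
    avoid []      p b-inj = _ , ⊑-refl , b-inj , λ ()
    avoid (s ∷ L) p b-inj =
      let b′ , q , b′-inj , ¬s = avoid₁ s p b-inj
          b″ , r , b″-inj , ¬L = avoid L (⊑-trans q p) b′-inj
      in b″ , ⊑-trans r q , b″-inj , λ { (here refl) t → ¬s (here refl) (⊑-sums r t) ; (there s∈) → ¬L s∈ }

    Inv : List S → Seq → Set
    Inv L b = b ⊑ a × Bijective b × ∀ {l} → l ∈ L → ¬ Sums b 0 l

    grow : ∀ {L b} → Inv L b → Σ ℕ λ m → Σ S λ x → Σ Seq λ b′ →
           x ∉ L × Sum b 0 m x × b′ ⊑[ m ] b × Inv (extend L x) b′
    grow {L} {b} (p , b-inj , avoids) =
      -- The extended list contains every sum involving the new term `b 0`, so later sums will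
      -- differ from these too.
      let b′ , q , b′-inj , avoids′ = avoid (extend L (b 0)) (⊑-trans (⊑-weaken z≤n (drop-⊑ 1)) p)
                                        (drop-injective 1 b-inj)
          q₁ = ⊑-trans q (drop-⊑ 1)
      in 1 , b 0 , b′ , (λ x∈ → avoids x∈ (term 0)) , last z≤n ≤-refl , q₁
       , ⊑-trans (⊑-weaken z≤n q₁) p , b′-inj , avoids′

    open Build {λ L x → x ∉ L} {Inv} grow

  -- mult s n is the (n + 1)-fold sum of s.
  mult : S → ℕ → S
  mult s zero    = s
  mult s (suc n) = s ∙ mult s n

  mult-+ : ∀ s m n → mult s m ∙ mult s n ≡ mult s (suc (m + n))
  mult-+ s zero    n = refl
  mult-+ s (suc m) n = trans (assoc _ _ _) (cong (s ∙_) (mult-+ s m n))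

  mult-idempotent : ∀ s {i j} → i < j → mult s i ≡ mult s j → Σ ℕ λ m → mult s m ∙ mult s m ≡ mult s m
  mult-idempotent s {i} {j} i<j eq = m , (begin
    mult s m ∙ mult s m               ≡⟨ mult-+ s m m ⟩
    mult s (suc (m + m))              ≡⟨ cong (mult s) arithmetic ⟩
    mult s (suc i * d + m)            ≡⟨ periodic (suc i) (suc i * d₁) ⟨
    mult s m                          ∎)
    where
    open ≡-Reasoning
    d₁ d m : ℕ
    d₁ = proj₁ (m≤n⇒∃[o]m+o≡n i<j)
    d  = suc d₁
    -- As `mult s m` is the (m + 1)-fold sum, m + 1 = (i + 1) * d is chosen: a multiple of the
    -- period `d` that is at least i + 1. Doubling it adds only whole periods.
    m  = suc i * d₁ + i
    arithmetic : suc (m + m) ≡ suc i * d + m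
    arithmetic = solve 2 (λ i e → con 1 :+ (((con 1 :+ i) :* e :+ i) :+ ((con 1 :+ i) :* e :+ i)) :=
                   (con 1 :+ i) :* (con 1 :+ e) :+ ((con 1 :+ i) :* e :+ i)) refl i d₁
      where open +-*-Solver
    d+i≡j : d + i ≡ j
    d+i≡j = trans (cong suc (+-comm d₁ i)) (proj₂ (m≤n⇒∃[o]m+o≡n i<j))
    shift-eq : ∀ k → mult s (k + i) ≡ mult s (k + (d + i))
    shift-eq zero    = trans eq (cong (mult s) (sym d+i≡j))
    shift-eq (suc k) = cong (s ∙_) (shift-eq k)
    periodic : ∀ t k → mult s (k + i) ≡ mult s (t * d + (k + i))
    periodic zero    k = refl
    periodic (suc t) k = begin
      mult s (k + i)                 ≡⟨ periodic t k ⟩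
      mult s (t * d + (k + i))       ≡⟨ cong (mult s) (+-assoc (t * d) k i) ⟨
      mult s (t * d + k + i)         ≡⟨ shift-eq (t * d + k) ⟩
      mult s (t * d + k + (d + i))   ≡⟨ cong (mult s) (solve 4 (λ a k d i →
                                          a :+ k :+ (d :+ i) := d :+ a :+ (k :+ i)) refl (t * d) k d i) ⟩
      mult s (d + t * d + (k + i))   ∎
      where open +-*-Solver

  -- By `recurs`, `s` is a sum beyond every position. This turns all multiples of `s` into sums of
  -- `b`.
  constant-⊑ : ∀ {b s} → Bijective b → Unavoidable b s → (λ _ → s) ⊑ b
  constant-⊑ {b} b-inj u = blocks g z≤n λ n → proj₂ (recurs b-inj u (g n))
    where
    g : ℕ → ℕ
    g zero    = 0
    g (suc n) = proj₁ (recurs b-inj u (g n))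

  mult-sum : ∀ {s} k {p} → Sum (λ _ → s) p (suc k + p) (mult s k)
  mult-sum zero    = last ≤-refl ≤-refl
  mult-sum {s} (suc k) {p} =
    cons ≤-refl (subst (λ q → Sum (λ _ → s) (suc p) q (mult s k)) (+-suc (suc k) p) (mult-sum k))

  -- If two multiples of `s` agree, some multiple is idempotent, and it is unavoidable because
  -- `constant-⊑` holds in every injective sumsequence. If all multiples differ, they provide an
  -- injective sumsequence that avoids `s`.
  unavoidable-idempotent : ∀ {b s} → Bijective b → Unavoidable b s →
                           Σ S λ e → e ∙ e ≡ e × Unavoidable b e
  unavoidable-idempotent {b} {s} b-inj u with lem (Σ ℕ λ i → Σ ℕ λ j → i < j × mult s i ≡ mult s j)
  ... | yes (i , j , i<j , eq) =
    let m , idem = mult-idempotent s i<j eq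
    in mult s m , idem , λ p b′-inj →
         ⊑-sums (constant-⊑ b′-inj (unavoidable-⊑ p u)) (_ , mult-sum m {0})
  ... | no infinite-order = ⊥-elim absurd
    where
    c : Seq
    -- Starting with the twofold sum keeps `s` itself out of the sums of `c`.
    c n = mult s (suc n)
    h : ℕ → ℕ
    h zero    = 0
    h (suc n) = suc (suc n) + h n
    c-injective : Bijective c
    c-injective = ≢⇒injective λ {i} {j} i<j eq → infinite-order (suc i , suc j , s≤s i<j , eq)
    c-sum : ∀ {m n x} → Sum c m n x → Σ ℕ λ k → x ≡ mult s (suc k)
    c-sum (last {i = i} _ _) = i , refl
    c-sum (cons {i = i} _ p) with c-sum p
    ... | k , refl = suc (i + suc k) , mult-+ s (suc i) (suc k)
    absurd : ⊥
    absurd with u (⊑-trans (blocks h z≤n (λ n → mult-sum (suc n))) (constant-⊑ b-inj u)) c-injective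
    ... | _ , p = let k , eq = c-sum p in infinite-order (0 , suc k , s≤s z≤n , eq)

  ExitPoint : Seq → (S → Set) → Set
  ExitPoint b Z = Σ ℕ λ m → Σ S λ x → Σ (ℕ → ℕ) λ ψ →
    Incr ψ × m ≤ ψ 0 × Sum b 0 m x × ¬ Z x × ∀ j → Z (x ∙ b (ψ j))

  -- Otherwise a sumsequence can be chosen greedily with all its finite sums outside Z ∋ e.
  abstract
    exit-point : ∀ {b e} → Bijective b → Unavoidable b e → {Z : S → Set} → Z e →
                 (zs : List S) → (∀ {z} → Z z → z ∈ zs) → ExitPoint b Z
    exit-point {b} {e} b-inj u {Z} Ze zs Z⊆zs = by-contra absurd
      where
      module _ (none : ¬ ExitPoint b Z) where

        Outside : ℕ → S → Set
        Outside n l = Sum b 0 n l × ¬ Z l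

        Inv : List S → Seq → Set
        -- The sequence stays a subsequence of `b`, not just a sumsequence, because an exit point
        -- adds single terms of `b`.
        Inv L b′ = Σ ℕ λ n → Σ (ℕ → ℕ) λ φ → b′ ≡ b ∘ φ × Incr φ × n ≤ φ 0 ×
                   ∀ {l} → l ∈ L → Outside n l × ∀ k → ¬ Z (l ∙ b (φ k))

        -- For each `l`, either infinitely many terms keep `l ∙ b (φ (ψ k))` outside `Z` and the
        -- sequence is thinned to these, or a whole tail leads into `Z`, which is an exit point at
        -- `l`.
        thin-list : ∀ L {n φ} → (∀ {l} → l ∈ L → Outside n l) → Incr φ → n ≤ φ 0 →
                    Σ (ℕ → ℕ) λ ψ → Incr ψ × ∀ {l} → l ∈ L → ∀ k → ¬ Z (l ∙ b (φ (ψ k)))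
        thin-list [] out φ↑ n≤ = id , n<1+n , λ ()
        thin-list (l ∷ L) {φ = φ} out φ↑ n≤ with thin-list L (out ∘ there) φ↑ n≤
        ... | ψ , ψ↑ , ¬L with thin (λ k → ¬ Z (l ∙ b (φ (ψ k))))
        ... | inj₁ inf = let θ , θ↑ , ¬l = enumerate inf in ψ ∘ θ , incr-∘ ψ↑ θ↑ , λ where
          (here refl) → ¬l
          (there l∈) k → ¬L l∈ (θ k)
        ... | inj₂ (θ , θ↑ , inZ) = ⊥-elim (none (_ , l , φ ∘ ψ ∘ θ , incr-∘ φ↑ (incr-∘ ψ↑ θ↑)
                , ≤-trans n≤ (incr-0≤ φ↑ _) , proj₁ (out (here refl)) , proj₂ (out (here refl))
                , λ j → by-contra (inZ j)))

        grow : ∀ {L b′} → Inv L b′ → Σ ℕ λ m → Σ S λ x → Σ Seq λ b″ →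
               x ∉ L × Sum b′ 0 m x × b″ ⊑[ m ] b′ × Inv (extend L x) b″
        grow {L} (n , φ , refl , φ↑ , n≤ , inv) =
          suc N , x , b ∘ φ′ ∘ ψ , (λ x∈ → fresh (∈-++⁺ʳ zs x∈)) , last z≤n ≤-refl
          , ⊑-weaken (m≤m+n (suc N) (ψ 0)) (subseq-⊑ (incr-∘ (incr-+ (suc N)) ψ↑))
          , suc (φ N) , φ′ ∘ ψ , refl , incr-∘ φ′↑ ψ↑ , ≤-trans n′≤ (incr-0≤ φ′↑ _)
          , λ l∈ → out l∈ , ¬Z l∈
          where
          N : ℕ
          N = proj₁ (injective-avoids (bijective-∘ b-inj φ↑) (zs ++ L))
          x : S
          x = b (φ N)
          fresh : x ∉ zs ++ L
          fresh = proj₂ (injective-avoids (bijective-∘ b-inj φ↑) (zs ++ L)) N ≤-refl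
          φ′ : ℕ → ℕ
          φ′ k = φ (suc N + k)
          φ′↑ : Incr φ′
          φ′↑ = incr-∘ φ↑ (incr-+ (suc N))
          n′≤ : suc (φ N) ≤ φ′ 0
          n′≤ = incr-< φ↑ (m≤m+n (suc N) 0)
          n≤φN : n ≤ φ N
          n≤φN = ≤-trans n≤ (incr-0≤ φ↑ N)
          out : ∀ {l} → l ∈ extend L x → Outside (suc (φ N)) l
          out = extend-elim (Outside (suc (φ N)))
            (last z≤n ≤-refl , λ z → fresh (∈-++⁺ˡ (Z⊆zs z)))
            (λ l∈ → let (s , ¬z) , _ = inv l∈ in widenʳ (m≤n⇒m≤1+n n≤φN) s , ¬z)
            (λ l∈ → let (s , _) , ¬z = inv l∈ in append s (last n≤φN ≤-refl) , ¬z N)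
          thinned = thin-list (extend L x) out φ′↑ n′≤
          ψ = proj₁ thinned
          ψ↑ = proj₁ (proj₂ thinned)
          ¬Z = proj₂ (proj₂ thinned)

        open Build {λ L x → x ∉ L} {Inv} grow

        absurd : ⊥
        absurd with build {b} (0 , id , refl , n<1+n , z≤n , λ ())
        ... | c , c⊑b , at =
          let c-inj = build-injective λ n → let L , _ , _ , ∉L , collect , _ = at n in L , ∉L , collect
              n , p = u c⊑b c-inj
              _ , _ , (_ , _ , _ , _ , _ , inv) , _ , collect , _ = at n
          in proj₂ (proj₁ (inv (collect p))) Ze

  -- Idempotents that are left identities

  LeftIdentity : S → Seq → Set
  LeftIdentity e b = ∀ j → e ∙ b j ≡ b j

  leftIdentity-sum : ∀ {e b m n x} → LeftIdentity e b → Sum b m n x → e ∙ x ≡ x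
  leftIdentity-sum id-b (last _ _) = id-b _
  leftIdentity-sum id-b (cons _ p) = trans (sym (assoc _ _ _)) (cong (_∙ _) (id-b _))

  leftIdentity-⊑ : ∀ {e b b′ m} → b′ ⊑[ m ] b → LeftIdentity e b → LeftIdentity e b′
  leftIdentity-⊑ p id-b j = leftIdentity-sum id-b (sums p j)

  -- If `x` were a sum with first term `b i`, then `x ∙ b i ≡ e` would cancel that term in `x ∙ x`.
  -- This expresses every `b l` by one element not depending on `l`, against injectivity.
  left-inverse-not-sum : ∀ {b e x} → Bijective b → LeftIdentity e b → (∀ j → x ∙ b j ≡ e) → ¬ Sums b 0 x
  left-inverse-not-sum {b} {e} b-inj id-b inverse (_ , p) =
    let w , const = constant inverse p
    in contradiction (b-inj {0} {1} (trans (const 0) (sym (const 1)))) λ ()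
    where
    open ≡-Reasoning
    constant : ∀ {m n x} → (∀ j → x ∙ b j ≡ e) → Sum b m n x → Σ S λ w → ∀ l → b l ≡ w
    constant {x = x} inverse (last {i = i} _ _) = x ∙ e , λ l → begin
      b l                ≡⟨ id-b l ⟨
      e ∙ b l            ≡⟨ cong (_∙ b l) (inverse i) ⟨
      (x ∙ x) ∙ b l      ≡⟨ assoc _ _ _ ⟩
      x ∙ (x ∙ b l)      ≡⟨ cong (x ∙_) (inverse l) ⟩
      x ∙ e              ∎
    constant {x = x} inverse (cons {i = i} {x = y} _ p) = b i ∙ e , λ l → begin
      b l                                ≡⟨ step l ⟨
      x ∙ (b 0 ∙ b l)                    ≡⟨ cong (_∙ (b 0 ∙ b l)) x≡ ⟨
      (b i ∙ (x ∙ x)) ∙ (b 0 ∙ b l)      ≡⟨ assoc _ _ _ ⟩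
      b i ∙ ((x ∙ x) ∙ (b 0 ∙ b l))      ≡⟨ cong (b i ∙_) (assoc _ _ _) ⟩
      b i ∙ (x ∙ (x ∙ (b 0 ∙ b l)))      ≡⟨ cong (λ z → b i ∙ (x ∙ z)) (step l) ⟩
      b i ∙ (x ∙ b l)                    ≡⟨ cong (b i ∙_) (inverse l) ⟩
      b i ∙ e                            ∎
      where
      step : ∀ l → x ∙ (b 0 ∙ b l) ≡ b l
      step l = trans (sym (assoc _ _ _)) (trans (cong (_∙ b l) (inverse 0)) (id-b l))
      x≡ : b i ∙ (x ∙ x) ≡ x
      x≡ = cong (b i ∙_) (begin
        x ∙ (b i ∙ y)    ≡⟨ assoc _ _ _ ⟨
        (x ∙ b i) ∙ y    ≡⟨ cong (_∙ y) (inverse i) ⟩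
        e ∙ y            ≡⟨ leftIdentity-sum id-b p ⟩
        y                ∎)

  -- With x₀ ∙ b j = e for all j, the products z = y ∙ x of b-sums with x ∙ b j = e satisfy x₀ ∙ z_F = x
  -- for the last factor x of z_F, so a sumsequence of such z never sums to e.
  ¬unavoidable-leftIdentity : ∀ {b e} → Bijective b → e ∙ e ≡ e → LeftIdentity e b → ¬ Unavoidable b e
  ¬unavoidable-leftIdentity {b} {e} b-inj idem id-b u
    with exit-point b-inj u {_≡ e} refl (e ∷ []) here
  ... | _ , x₁ , ψ₀ , ψ₀↑ , _ , _ , _ , x₁-inv =
    let c , c⊑b , at = build {b ∘ ψ₀} (b₁⊑b , bijective-∘ b-inj ψ₀↑ , x₀-inv , λ ())
        c-inj = build-injective λ n → let L , _ , _ , ∉L , collect , _ = at n in L , ∉L , collect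
        n , p = u (⊑-trans c⊑b b₁⊑b) c-inj
        _ , _ , (_ , _ , _ , inv) , _ , collect , _ = at n
    in proj₁ (inv (collect p)) refl
    where
    b₁⊑b : b ∘ ψ₀ ⊑ b
    b₁⊑b = ⊑-weaken z≤n (subseq-⊑ ψ₀↑)

    x₀ : S
    -- The factor `e` ensures `x₀ ∙ e ≡ x₀`: a sum `l ≡ e` would then force `x ≡ x₀`, which `x-not`
    -- excludes.
    x₀ = x₁ ∙ e

    x₀-inv : ∀ j → x₀ ∙ b (ψ₀ j) ≡ e
    x₀-inv j = trans (assoc _ _ _) (trans (cong (x₁ ∙_) (id-b _)) (x₁-inv j))

    x₀∙e : x₀ ∙ e ≡ x₀
    x₀∙e = trans (assoc _ _ _) (cong (x₁ ∙_) idem)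

    Inv : List S → Seq → Set
    Inv L b′ = b′ ⊑ b × Bijective b′ × (∀ j → x₀ ∙ b′ j ≡ e) ×
               ∀ {l} → l ∈ L → l ≢ e × ∀ j → (x₀ ∙ l) ∙ b′ j ≡ e

    grow : ∀ {L b′} → Inv L b′ → Σ ℕ λ m → Σ S λ x → Σ Seq λ b″ →
           x ∉ L × Sum b′ 0 m x × b″ ⊑[ m ] b′ × Inv (extend L x) b″
    grow {L} {b′} (p , b′-inj , b′-inv , inv)
      with exit-point (drop-injective 1 b′-inj) (unavoidable-⊑ (⊑-trans (drop-⊑ 1) p) u) {_≡ e} refl (e ∷ []) here
    ... | m , x , ψ , ψ↑ , m≤ , x-sum , _ , x-inv =
      suc m , z , b′ ∘ suc ∘ ψ
      -- Here `x₀ ∙ z ≡ x`. If `z` were in `L`, then `x ∙ b′ j ≡ e` for all `j`, although `x` is a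
      -- sum of `b′`. The new `x-inv` covers only the later subsequence and causes no conflict.
      , (λ z∈ → x-not (trans (sym (assoc _ _ _)) (cancel (b′-inv 0))) (proj₂ (inv z∈)))
      , cons z≤n x-sum′ , q
      , ⊑-trans (⊑-weaken z≤n q) p , bijective-∘ (drop-injective 1 b′-inj) ψ↑ , (λ j → b′-inv _)
      , extend-elim (λ l → l ≢ e × ∀ j → (x₀ ∙ l) ∙ b′ (suc (ψ j)) ≡ e)
          (new (trans (sym (assoc _ _ _)) (cancel (b′-inv 0))))
          (λ l∈ → proj₁ (inv l∈) , λ j → proj₂ (inv l∈) _)
          (λ {l} l∈ → new (begin
            x₀ ∙ (l ∙ (b′ 0 ∙ x))     ≡⟨ assoc _ _ _ ⟨
            (x₀ ∙ l) ∙ (b′ 0 ∙ x)     ≡⟨ assoc _ _ _ ⟨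
            ((x₀ ∙ l) ∙ b′ 0) ∙ x     ≡⟨ cancel (proj₂ (inv l∈) 0) ⟩
            x                         ∎))
      where
      open ≡-Reasoning
      z : S
      -- The leading `b′ 0` is cancelled by `x₀` and by `x₀ ∙ l` for every earlier `l`, so that
      -- exactly `x` remains in each case.
      z = b′ 0 ∙ x
      x-sum′ : Sum b′ 1 (suc m) x
      x-sum′ = ⊑-sum (drop-⊑ 1) x-sum
      q : b′ ∘ suc ∘ ψ ⊑[ suc m ] b′
      q = ⊑-trans-pos (⊑-weaken m≤ (subseq-⊑ ψ↑)) (drop-⊑ 1)
      id-b′ : LeftIdentity e b′
      id-b′ = leftIdentity-⊑ p id-b
      cancel : ∀ {w} → w ≡ e → w ∙ x ≡ x
      cancel refl = leftIdentity-sum id-b′ x-sum′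
      x-not : ∀ {w} → w ≡ x → ¬ (∀ j → w ∙ b′ j ≡ e)
      x-not refl inverse = left-inverse-not-sum b′-inj id-b′ inverse (_ , widenˡ z≤n x-sum′)
      new : ∀ {l} → x₀ ∙ l ≡ x → l ≢ e × ∀ j → (x₀ ∙ l) ∙ b′ (suc (ψ j)) ≡ e
      new eq = (λ { refl → x-not (trans (sym x₀∙e) eq) b′-inv })
             , λ j → trans (cong (_∙ _) eq) (x-inv j)

    open Build {λ L x → x ∉ L} {Inv} grow

  -- Unavoidable idempotents in general

  module ConstantPairs
    (no-constant : ∀ {x e s} → Bijective x → e ∙ e ≡ e → Unavoidable x e → ¬ (∀ {i j} → i < j → x i ∙ x j ≡ s))
    where

    no-finite-pairs : ∀ {x e} → Bijective x → e ∙ e ≡ e → Unavoidable x e →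
                      (xs : List S) → ¬ (∀ {i j} → i < j → x i ∙ x j ∈ xs)
    no-finite-pairs {x} x-inj idem u xs pair∈ =
      let φ , φ↑ , _ , const = ramsey {f = λ i j → x i ∙ x j} xs pair∈
      in no-constant (bijective-∘ x-inj φ↑) idem (unavoidable-⊑ (subseq-⊑ φ↑) u) const

    abstract
      -- By `no-finite-pairs`, the two-term sums beyond any position are not confined to a finite
      -- list.
      pair-sums : ∀ {b e} → Bijective b → e ∙ e ≡ e → Unavoidable b e →
        Σ Seq λ c → c ⊑ b × Bijective c × ∀ k → Σ ℕ λ i → Σ ℕ λ j → c k ≡ b i ∙ b j
      pair-sums {b} b-inj idem u = result (select pick)
        where
        W : ℕ → ℕ → S → Set
        W N m y = Σ ℕ λ i → Σ ℕ λ j → N ≤ i × i < j × j < m × y ≡ b i ∙ b j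
        pick : ∀ N (L : List S) → Σ ℕ λ m → Σ S λ y → W N m y × y ∉ L
        pick N L = by-contra λ none →
          no-finite-pairs (drop-injective N b-inj) idem (unavoidable-⊑ (drop-⊑ N) u) L λ {i} {j} i<j →
            by-contra λ ∉L → none (suc (N + j) , b (N + i) ∙ b (N + j)
              , (N + i , N + j , m≤m+n N i , +-monoʳ-< N i<j , ≤-refl , refl) , ∉L)
        result : (Σ (ℕ → ℕ) λ g → Σ Seq λ c → (∀ k → W (g k) (g (suc k)) (c k)) × Bijective c) →
                 Σ Seq λ c → c ⊑ b × Bijective c × ∀ k → Σ ℕ λ i → Σ ℕ λ j → c k ≡ b i ∙ b j
        result (g , c , w , c-inj) =
          c , blocks g z≤n c-sum , c-inj , λ k → let i , j , _ , _ , _ , eq = w k in i , j , eq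
          where
          c-sum : ∀ k → Sum b (g k) (g (suc k)) (c k)
          c-sum k with w k
          ... | i , j , N≤i , i<j , j<m , eq = subst (Sum b _ _) (sym eq) (cons N≤i (last i<j j<m))

    -- Every l chosen so far satisfies l ∙ b j ∈ V for all later b j, so c i ∙ c j ∈ V whenever i < j.
    no-finite-right-ideal : ∀ {b e} → Bijective b → e ∙ e ≡ e → Unavoidable b e → {V : S → Set} → V e →
      (∀ {v y} → V v → Sums b 0 y → V (v ∙ y)) → (vs : List S) → ¬ (∀ {v} → V v → v ∈ vs)
    no-finite-right-ideal {b} {e} b-inj idem u {V} Ve V-closed vs V⊆vs =
      let c , c⊑b , at = build {b} (⊑-refl , b-inj , λ ())
          c-inj = build-injective λ n → let L , _ , _ , ∉L , collect , _ = at n in L , ∉L , collect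
      in no-finite-pairs c-inj idem (unavoidable-⊑ c⊑b u) vs λ {i} {j} i<j →
           let _ , _ , (p , _ , inv) , _ , collect , q = at j
           in V⊆vs (absorb p (inv (collect (last z≤n i<j))) (⊑-sums q (sums-drop j {c} (term j))))
      where
      absorb : ∀ {b′ l y} → b′ ⊑ b → (∀ j → V (l ∙ b′ j)) → Sums b′ 0 y → V (l ∙ y)
      absorb p Vl (_ , last _ _) = Vl _
      absorb p Vl (_ , cons _ q) = subst V (assoc _ _ _) (V-closed (Vl _) (⊑-sums p (_ , widenˡ z≤n q)))

      Inv : List S → Seq → Set
      Inv L b′ = b′ ⊑ b × Bijective b′ × ∀ {l} → l ∈ L → ∀ j → V (l ∙ b′ j)

      module Grow {L : List S} {b′ : Seq} (p : b′ ⊑ b) (b′-inj : Bijective b′)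
                  (inv : ∀ {l} → l ∈ L → ∀ j → V (l ∙ b′ j)) where

        Z : S → Set
        -- Including `L` makes the exit point new. A sum that enters `L` rather than `V` is carried
        -- into `V` by one more term, which is why `b″` consists of two-term sums.
        Z z = V z ⊎ z ∈ L

        exit : ExitPoint b′ Z
        exit = exit-point b′-inj (unavoidable-⊑ p u) (inj₁ Ve) (vs ++ L)
                 (λ { (inj₁ v) → ∈-++⁺ˡ (V⊆vs v) ; (inj₂ z∈) → ∈-++⁺ʳ vs z∈ })

        module _ {m x ψ b″} (ψ↑ : Incr ψ) (m≤ : m ≤ ψ 0) (x-sum : Sum b′ 0 m x) (xψ∈ : ∀ j → Z (x ∙ b′ (ψ j)))
                 (b″⊑ : b″ ⊑ b′ ∘ ψ) (pairs : ∀ k → Σ ℕ λ i → Σ ℕ λ j → b″ k ≡ b′ (ψ i) ∙ b′ (ψ j)) where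

          q : b″ ⊑[ m ] b′
          q = ⊑-trans b″⊑ (⊑-weaken m≤ (subseq-⊑ ψ↑))

          b″-sum : ∀ k → Sums b′ 0 (b″ k)
          b″-sum k = ⊑-sums (⊑-weaken z≤n q) (suc k , last z≤n ≤-refl)

          b′-sum : ∀ k → Sums b 0 (b′ k)
          b′-sum k = ⊑-sums p (suc k , last z≤n ≤-refl)

          two : ∀ {z} j → Z z → V (z ∙ b′ (ψ j))
          two j (inj₁ v)  = V-closed v (b′-sum (ψ j))
          two j (inj₂ z∈) = inv z∈ (ψ j)

          new : ∀ k → V (x ∙ b″ k)
          new k = let i , j , eq = pairs k in
            subst V (trans (assoc x (b′ (ψ i)) (b′ (ψ j))) (cong (x ∙_) (sym eq))) (two j (xψ∈ i))

          extended : ∀ {l} → l ∈ extend L x → ∀ k → V (l ∙ b″ k)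
          extended = extend-elim (λ l → ∀ k → V (l ∙ b″ k)) new
            (λ l∈ k → absorb p (inv l∈) (b″-sum k))
            (λ l∈ k → V-closed (absorb p (inv l∈) (m , x-sum)) (⊑-sums p (b″-sum k)))

      grow : ∀ {L b′} → Inv L b′ → Σ ℕ λ m → Σ S λ x → Σ Seq λ b″ →
             x ∉ L × Sum b′ 0 m x × b″ ⊑[ m ] b′ × Inv (extend L x) b″
      grow {L} {b′} (p , b′-inj , inv) =
        let open Grow p (λ {i} {j} → b′-inj {i} {j}) inv
            m , x , ψ , ψ↑ , m≤ , x-sum , x∉ , xψ∈ = exit
            b″ , b″⊑ , b″-inj , pairs =
              pair-sums (bijective-∘ b′-inj ψ↑) idem (unavoidable-⊑ (⊑-trans (subseq-⊑ ψ↑) p) u)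
            q′ = q ψ↑ m≤ x-sum xψ∈ b″⊑ pairs
        in m , x , b″ , (λ x∈ → x∉ (inj₂ x∈)) , x-sum , q′ , ⊑-trans (⊑-weaken z≤n q′) p
         , b″-inj , extended ψ↑ m≤ x-sum xψ∈ b″⊑ pairs

      open Build {λ L x → x ∉ L} {Inv} grow

    no-unavoidable-idempotent : ∀ {b e} → Bijective b → e ∙ e ≡ e → ¬ Unavoidable b e
    no-unavoidable-idempotent {b} {e} b-inj idem u
      with lem (Σ ℕ λ N → Σ (List S) λ vs → ∀ {y} → Sums b N y → e ∙ y ∈ vs)
    ... | yes (N , vs , finite) =
      no-finite-right-ideal (drop-injective M b-inj) idem (unavoidable-⊑ (drop-⊑ M) u) {V} (inj₁ refl)
        V-closed (e ∷ vs) λ { (inj₁ refl) → here refl ; (inj₂ (y , s , refl)) → there (finite s) }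
      where
      Recurring : ℕ → S → Set
      Recurring M v = Σ S λ y → Sum b N M y × v ≡ e ∙ y
      V : S → Set
      V v = v ≡ e ⊎ Σ S λ y → Sums b N y × v ≡ e ∙ y
      -- Each of the finitely many elements `e ∙ y` is given a representative `y` that ends before a
      -- common `M`. Sums beyond `M` can then be appended, so `V` is closed.
      bound : ∀ L → Σ ℕ λ M → N ≤ M × ∀ {v} → v ∈ L → (Σ S λ y → Sums b N y × v ≡ e ∙ y) → Recurring M v
      bound [] = N , ≤-refl , λ ()
      bound (v ∷ L) with bound L | lem (Σ S λ y → Sums b N y × v ≡ e ∙ y)
      ... | M , N≤M , f | no ¬v = M , N≤M , λ { (here refl) h → ⊥-elim (¬v h) ; (there v∈) → f v∈ }
      ... | M , N≤M , f | yes (y , (k , s) , eq) = M + k , ≤-trans N≤M (m≤m+n M k) , λ where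
        (here refl) _ → y , widenʳ (m≤n+m k M) s , eq
        (there v∈) h → let y′ , s′ , eq′ = f v∈ h in y′ , widenʳ (m≤m+n M k) s′ , eq′
      M : ℕ
      M = proj₁ (bound vs)
      V-closed : ∀ {v y} → V v → Sums (drop M b) 0 y → V (v ∙ y)
      V-closed (inj₁ refl) t = inj₂ (_ , ⊑-sums (⊑-weaken (proj₁ (proj₂ (bound vs))) (drop-⊑ M)) t , refl)
      V-closed (inj₂ h@(y , s , refl)) t =
        let y′ , s′ , eq = proj₂ (proj₂ (bound vs)) (finite s) h
            k , t′ = ⊑-sums (drop-⊑ M) t
        in inj₂ (_ , (k , append s′ t′) , trans (cong (_∙ _) eq) (assoc _ _ _))
    ... | no infinite = result (select pick)
      where
      W : ℕ → ℕ → S → Set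
      W N m y = Sum b N m y × e ∙ y ≡ y
      pick : ∀ N (L : List S) → Σ ℕ λ m → Σ S λ y → W N m y × y ∉ L
      -- Since `e` recurs beyond `N`, each `e ∙ y` with `y` still further on is a sum of `b`, and
      -- idempotence makes `e` a left identity for it.
      pick N L = by-contra λ none → let k , s = recurs b-inj u N in
        infinite (k , L , λ {y} (m , t) → by-contra λ ∉L →
          none (m , e ∙ y , (append s t , trans (sym (assoc _ _ _)) (cong (_∙ y) idem)) , ∉L))
      result : ¬ (Σ (ℕ → ℕ) λ g → Σ Seq λ c → (∀ k → W (g k) (g (suc k)) (c k)) × Bijective c)
      result (g , c , w , c-inj) =
        ¬unavoidable-leftIdentity c-inj idem (λ k → proj₂ (w k))
          (unavoidable-⊑ (blocks g z≤n λ k → proj₁ (w k)) u)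

    proper-sumsequence : ∀ a → Bijective a → Σ Seq λ c → Sumsequence _∙_ a c × Proper _∙_ c
    proper-sumsequence a a-inj =
      let c , c⊑a , sep = separated-sumsequence a-inj λ _ b-inj u →
            let e , idem , u′ = unavoidable-idempotent b-inj u in no-unavoidable-idempotent b-inj idem u′
      in c , ⊑⇒sumsequence c⊑a , separated⇒proper sep

-- Sequences with constant pair sums contain a forbidden semigroup

module Forbidden {S : Set} (_∙_ : S → S → S) (assoc : (x y z : S) → (x ∙ y) ∙ z ≡ x ∙ (y ∙ z))
            (em : ExcludedMiddle (Level.suc 0ℓ)) where

  open Classical em
  open Blocks _∙_ assoc
  open Unavoidability _∙_ assoc em
  open Implications _∙_ assoc em using (C3)
  open ≡-Reasoning

  everywhere : Inf (λ n → 0 ≤ n)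
  everywhere N = N , ≤-refl , z≤n

  module _ (c3 : C3) where

    -- The source of type (a): the `z i`, their pairwise products and `C` form an infinite
    -- subsemigroup with all products in the finite set `P`. Products of two `z i` need only lie in
    -- `P`; those of three or more fall into `C`.
    no-finite-products : {z : Seq} → Bijective z → {P C : S → Set} (ps : List S) → (∀ {y} → P y → y ∈ ps) →
      (∀ {y} → C y → P y) → (∀ i j → P (z i ∙ z j)) → (∀ i {y} → P y → C (z i ∙ y)) →
      (∀ i {y} → C y → C (y ∙ z i)) → ¬ (∀ {y y′} → C y → C y′ → C (y ∙ y′))
    no-finite-products {z} z-inj {P} {C} ps P⊆ps C⊆P zz zP Cz CC =
      proj₁ c3 (T , sub , infinite , ps , λ { _ (_ , _ , s , t , refl) → P⊆ps (product s t) })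
      where
      T : S → Set
      T y = (Σ ℕ λ i → y ≡ z i) ⊎ (Σ ℕ λ i → Σ ℕ λ j → y ≡ z i ∙ z j) ⊎ C y
      zC : ∀ i {y} → C y → C (z i ∙ y)
      zC i c = zP i (C⊆P c)
      infinite : InfiniteP T
      infinite (xs , f) = let N , ∉xs = injective-avoids z-inj xs in ∉xs N ≤-refl (f _ (inj₁ (N , refl)))
      zzT : ∀ i j {y} → T y → C ((z i ∙ z j) ∙ y)
      zzT i j (inj₁ (k , refl))              = subst C (sym (assoc _ _ _)) (zP i (zz j k))
      zzT i j (inj₂ (inj₁ (k , l , refl)))   = subst C (sym (assoc _ _ _)) (zC i (zP j (zz k l)))
      zzT i j (inj₂ (inj₂ c))                = subst C (sym (assoc _ _ _)) (zC i (zC j c))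
      CT : ∀ {y y′} → C y → T y′ → C (y ∙ y′)
      CT c (inj₁ (k , refl))            = Cz k c
      CT c (inj₂ (inj₁ (k , l , refl))) = subst C (assoc _ _ _) (Cz l (Cz k c))
      CT c (inj₂ (inj₂ c′))             = CC c c′
      product : ∀ {y y′} → T y → T y′ → P (y ∙ y′)
      product (inj₁ (i , refl)) (inj₁ (j , refl))            = zz i j
      product (inj₁ (i , refl)) (inj₂ (inj₁ (k , l , refl))) = C⊆P (zP i (zz k l))
      product (inj₁ (i , refl)) (inj₂ (inj₂ c))              = C⊆P (zC i c)
      product (inj₂ (inj₁ (i , j , refl))) t                 = C⊆P (zzT i j t)
      product (inj₂ (inj₂ c)) t                              = C⊆P (CT c t)
      sub : IsSubsemigroup _∙_ T
      sub _ _ (inj₁ (i , refl)) (inj₁ (j , refl))            = inj₂ (inj₁ (i , j , refl))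
      sub _ _ (inj₁ (i , refl)) (inj₂ (inj₁ (k , l , refl))) = inj₂ (inj₂ (zP i (zz k l)))
      sub _ _ (inj₁ (i , refl)) (inj₂ (inj₂ c))              = inj₂ (inj₂ (zC i c))
      sub _ _ (inj₂ (inj₁ (i , j , refl))) t                 = inj₂ (inj₂ (zzT i j t))
      sub _ _ (inj₂ (inj₂ c)) t                              = inj₂ (inj₂ (CT c t))

    -- Null sequences and the three forbidden types

    record Null (w : Seq) (e : S) : Set where
      field
        injective : Bijective w
        distinct  : ∀ {i j} → i ≢ j → w i ∙ w j ≡ e
        zeroˡ     : ∀ i → e ∙ w i ≡ e
        zeroʳ     : ∀ i → w i ∙ e ≡ e
        idem      : e ∙ e ≡ e

      mult-zeroˡ : ∀ i m → e ∙ mult (w i) m ≡ e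
      mult-zeroˡ i zero    = zeroˡ i
      mult-zeroˡ i (suc m) = trans (sym (assoc _ _ _)) (trans (cong (_∙ mult (w i) m) (zeroˡ i)) (mult-zeroˡ i m))

      mult-zeroʳ : ∀ i m → mult (w i) m ∙ e ≡ e
      mult-zeroʳ i zero    = zeroʳ i
      mult-zeroʳ i (suc m) = trans (assoc _ _ _) (trans (cong (w i ∙_) (mult-zeroʳ i m)) (zeroʳ i))

      mult-distinct : ∀ {i j} → i ≢ j → ∀ m n → mult (w i) m ∙ mult (w j) n ≡ e
      mult-distinct {i} {j} i≢j m zero = go m
        where
        go : ∀ m → mult (w i) m ∙ w j ≡ e
        go zero    = distinct i≢j
        go (suc m) = trans (assoc _ _ _) (trans (cong (w i ∙_) (go m)) (zeroʳ i))
      mult-distinct {i} {j} i≢j m (suc n) =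
        trans (sym (assoc _ _ _)) (trans (cong (_∙ mult (w j) n) (mult-distinct i≢j m zero)) (mult-zeroˡ j n))

      mult-e : ∀ i {q} → mult (w i) q ≡ e → ∀ {m} → q ≤ m → mult (w i) m ≡ e
      mult-e i {q} eq {m} q≤m with m≤n⇒m<n∨m≡n q≤m
      ... | inj₂ refl = eq
      mult-e i {q} eq {suc m} _ | inj₁ (s≤s q≤m) = trans (cong (w i ∙_) (mult-e i eq q≤m)) (zeroʳ i)

    null-∘ : ∀ {w e φ} → Null w e → Incr φ → Null (w ∘ φ) e
    null-∘ {φ = φ} n φ↑ = record
      { injective = bijective-∘ injective φ↑
      ; distinct  = λ i≢j → distinct (i≢j ∘ incr-injective φ↑)
      ; zeroˡ     = zeroˡ ∘ φ
      ; zeroʳ     = zeroʳ ∘ φ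
      ; idem      = idem
      } where open Null n

    -- A copy of (c) with zero `e`. A multiple equal to `e` would equal the next one, against
    -- infinite order. If multiples for distinct indices agreed, the double of either would be `e`.
    infinite-orders : ∀ {w e} → Null w e → ¬ (∀ i {m n} → mult (w i) m ≡ mult (w i) n → m ≡ n)
    infinite-orders {w} {e} null ord = proj₂ (proj₂ c3) (f , f-inj , f-hom)
      where
      open Null null
      f : C → S
      f zeroC      = e
      f (pair i n) = mult (w i) n
      not-e : ∀ i m → mult (w i) m ≢ e
      not-e i m eq = 1+n≢n (ord i {suc m} {m} (trans (mult-e i eq (n≤1+n m)) (sym eq)))
      f-inj : ∀ {c d} → f c ≡ f d → c ≡ d
      f-inj {zeroC} {zeroC} _ = refl
      f-inj {zeroC} {pair i n} eq = contradiction (sym eq) (not-e i n)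
      f-inj {pair i m} {zeroC} eq = contradiction eq (not-e i m)
      f-inj {pair i m} {pair j n} eq with i ≟ j
      ... | yes refl = cong (pair i) (ord i eq)
      ... | no i≢j   = contradiction
        (trans (sym (mult-+ (w i) m m)) (trans (cong (mult (w i) m ∙_) eq) (mult-distinct i≢j m n)))
        (not-e i (suc (m + m)))
      f-hom : ∀ c d → f (c ⊞ d) ≡ f c ∙ f d
      f-hom zeroC zeroC = sym idem
      f-hom zeroC (pair i n) = sym (mult-zeroˡ i n)
      f-hom (pair i m) zeroC = sym (mult-zeroʳ i m)
      f-hom (pair i m) (pair j n) with i ≟ j
      ... | yes refl = sym (mult-+ (w i) m n)
      ... | no i≢j   = sym (mult-distinct i≢j m n)

    -- A copy of the fan with bottom `e`: two of the idempotents with distinct indices have product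
    -- `e`, so they are distinct since neither is `e`.
    nonzero-idempotents : ∀ {w e} → Null w e → (p : ℕ → ℕ) →
      (∀ i → mult (w i) (p i) ∙ mult (w i) (p i) ≡ mult (w i) (p i)) → ¬ (∀ i → mult (w i) (p i) ≢ e)
    nonzero-idempotents {w} {e} null p p-idem p≢e = proj₁ (proj₂ c3) (f , f-inj , f-hom)
      where
      open Null null
      f : ℕ → S
      f zero    = e
      f (suc i) = mult (w i) (p i)
      f-inj : Bijective f
      f-inj {zero}  {zero}  _  = refl
      f-inj {zero}  {suc j} eq = contradiction (sym eq) (p≢e j)
      f-inj {suc i} {zero}  eq = contradiction eq (p≢e i)
      f-inj {suc i} {suc j} eq with i ≟ j
      ... | yes refl = refl
      ... | no i≢j   = contradiction
        (trans (sym (p-idem i)) (trans (cong (mult (w i) (p i) ∙_) eq) (mult-distinct i≢j (p i) (p j)))) (p≢e i)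
      f-hom : ∀ m n → f (fan m n) ≡ f m ∙ f n
      f-hom m n with m ≟ n
      f-hom zero    .zero    | yes refl = sym idem
      f-hom (suc m) .(suc m) | yes refl = sym (p-idem m)
      f-hom zero zero        | no ne    = contradiction refl ne
      f-hom zero (suc n)     | no ne    = sym (mult-zeroˡ n (p n))
      f-hom (suc m) zero     | no ne    = sym (mult-zeroʳ m (p m))
      f-hom (suc m) (suc n)  | no ne    = sym (mult-distinct (ne ∘ cong suc) (p m) (p n))

    -- The last nonzero multiples y i of the w i have all products e. If they are all equal to v,
    -- the multiples just before them are distinct and have products e or v.
    no-nilpotent : ∀ {w e} → Null w e → ¬ (∀ i → Σ ℕ λ p → mult (w i) p ≡ e)
    no-nilpotent {w₀} {e} null₀ nil₀ = contradict
      where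
      N₀ : ℕ
      -- Beyond `N₀` no term is `e`, so a last nonzero multiple exists.
      N₀ = proj₁ (injective-avoids (Null.injective null₀) (e ∷ []))
      w : Seq
      w i = w₀ (N₀ + i)
      null : Null w e
      null = null-∘ null₀ (incr-+ N₀)
      open Null null
      w≢e : ∀ i → w i ≢ e
      w≢e i eq = proj₂ (injective-avoids (Null.injective null₀) (e ∷ [])) (N₀ + i) (m≤m+n N₀ i) (here eq)
      last-nonzero : ∀ i → Σ ℕ λ q → mult (w i) q ≢ e × mult (w i) (suc q) ≡ e
      last-nonzero i = let p , eq = nil₀ (N₀ + i) in go p eq
        where
        go : ∀ p → mult (w i) p ≡ e → Σ ℕ λ q → mult (w i) q ≢ e × mult (w i) (suc q) ≡ e
        go zero    eq = contradiction eq (w≢e i)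
        go (suc p) eq with lem (mult (w i) p ≡ e)
        ... | yes eq′ = go p eq′
        ... | no ne   = p , ne , eq
      q : ℕ → ℕ
      q i = proj₁ (last-nonzero i)
      y : Seq
      y i = mult (w i) (q i)
      y≢e : ∀ i → y i ≢ e
      y≢e i = proj₁ (proj₂ (last-nonzero i))
      beyond : ∀ i {m} → q i < m → mult (w i) m ≡ e
      beyond i = mult-e i (proj₂ (proj₂ (last-nonzero i)))

      module _ {φ v} (φ↑ : Incr φ) (y≡v : ∀ k → y (φ k) ≡ v) (w≢v : ∀ k → w (φ k) ≢ v) where

        q′ : ∀ k → Σ ℕ λ r → suc r ≡ q (φ k)
        q′ k with q (φ k) | y≡v k
        ... | zero  | eq = contradiction eq (w≢v k)
        ... | suc r | _  = r , refl

        r : ℕ → ℕ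
        r k = proj₁ (q′ k)

        z : Seq
        z k = mult (w (φ k)) (r k)

        φ-≢ : ∀ {i j} → i ≢ j → φ i ≢ φ j
        φ-≢ i≢j eq = i≢j (incr-injective φ↑ eq)

        z-suc : ∀ k → mult (w (φ k)) (suc (r k)) ≡ v
        z-suc k = trans (cong (mult (w (φ k))) (proj₂ (q′ k))) (y≡v k)

        z-inj : Bijective z
        z-inj {i} {j} eq with i ≟ j
        ... | yes i≡j = i≡j
        ... | no i≢j  = contradiction
          (trans (y≡v i) (trans (sym (z-suc i)) (trans (cong (w (φ i) ∙_) eq)
            (mult-distinct (φ-≢ i≢j) 0 (r j))))) (y≢e (φ i))

        -- For `r k` zero the square is the twofold multiple, which is `v`. Otherwise it lies beyond
        -- the last nonzero multiple.
        square : ∀ k → z k ∙ z k ≡ e ⊎ z k ∙ z k ≡ v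
        square k with q′ k | z-suc k
        ... | zero  , _  | eq = inj₂ eq
        ... | suc r , eq | _  = inj₁ (trans (mult-+ (w (φ k)) (suc r) (suc r))
                (beyond (φ k) (subst (_< suc (suc r + suc r)) eq (s≤s (s≤s (m≤n+m (suc r) r))))))

        absurd : ⊥
        absurd = no-finite-products z-inj {λ y → y ≡ e ⊎ y ≡ v} {_≡ e} (e ∷ v ∷ [])
          (λ { (inj₁ eq) → here eq ; (inj₂ eq) → there (here eq) }) inj₁ products
          (λ { i (inj₁ refl) → mult-zeroʳ (φ i) (r i)
             ; i (inj₂ refl) → trans (cong (z i ∙_) (sym (y≡v (suc i))))
                                 (mult-distinct (φ-≢ (1+n≢n ∘ sym)) (r i) (q (φ (suc i)))) })
          (λ { i refl → mult-zeroˡ (φ i) (r i) }) (λ { refl refl → idem })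
          where
          products : ∀ i j → z i ∙ z j ≡ e ⊎ z i ∙ z j ≡ v
          products i j with i ≟ j
          ... | yes refl = square i
          ... | no i≢j   = inj₁ (mult-distinct (φ-≢ i≢j) (r i) (r j))

      contradict : ⊥
      contradict with const⊎injective y everywhere
      ... | inj₂ (φ , φ↑ , _ , y-inj) =
        no-finite-products y-inj {_≡ e} {_≡ e} (e ∷ []) here id products
          (λ { i refl → mult-zeroʳ (φ i) (q (φ i)) }) (λ { i refl → mult-zeroˡ (φ i) (q (φ i)) })
          (λ { refl refl → idem })
        where
        products : ∀ i j → y (φ i) ∙ y (φ j) ≡ e
        products i j with i ≟ j
        ... | yes refl = trans (mult-+ (w (φ i)) (q (φ i)) (q (φ i))) (beyond (φ i) (s≤s (m≤m+n (q (φ i)) (q (φ i)))))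
        ... | no i≢j   = mult-distinct (i≢j ∘ incr-injective φ↑) (q (φ i)) (q (φ j))
      ... | inj₁ (v , inf) =
        let φ , φ↑ , yv = enumerate inf
            N , w∉ = injective-avoids (bijective-∘ injective φ↑) (v ∷ [])
        in absurd (incr-∘ φ↑ (incr-+ N)) (λ k → proj₂ (yv (N + k))) (λ k eq → w∉ (N + k) (m≤m+n N k) (here eq))

    no-finite-orders : ∀ {w e} → Null w e → ¬ (∀ i → Σ ℕ λ m → mult (w i) m ∙ mult (w i) m ≡ mult (w i) m)
    no-finite-orders {w} {e} null power with thin (λ i → mult (w i) (proj₁ (power i)) ≢ e)
    ... | inj₁ inf =
      let φ , φ↑ , ≢e = enumerate inf
      in nonzero-idempotents (null-∘ null φ↑) (λ i → proj₁ (power (φ i))) (λ i → proj₂ (power (φ i))) ≢e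
    ... | inj₂ (φ , φ↑ , ¬≢e) =
      no-nilpotent (null-∘ null φ↑) λ i → proj₁ (power (φ i)) , by-contra (¬≢e i)

    no-null : ∀ {w e} → ¬ Null w e
    no-null {w} {e} null with thin (λ i → ∀ {m n} → mult (w i) m ≡ mult (w i) n → m ≡ n)
    ... | inj₁ inf = let φ , φ↑ , ord = enumerate inf in infinite-orders (null-∘ null φ↑) ord
    ... | inj₂ (φ , φ↑ , ¬ord) = no-finite-orders (null-∘ null φ↑) λ i →
      let m , n , m<n , eq = coincide i in mult-idempotent (w (φ i)) m<n eq
      where
      coincide : ∀ i → Σ ℕ λ m → Σ ℕ λ n → m < n × mult (w (φ i)) m ≡ mult (w (φ i)) n
      coincide i = by-contra λ none → ¬ord i (≢⇒injective λ {m} {n} m<n eq → none (m , n , m<n , eq))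

    -- A n plays the role of the sum of any n + 2 distinct terms of x.
    record Homogeneous (x : Seq) : Set where
      field
        A         : ℕ → S
        k         : ℕ
        injective : Bijective x
        ascending : ∀ {i j} → i < j → x i ∙ x j ≡ A 0
        left      : ∀ i n → x i ∙ A n ≡ A (suc n)
        right     : ∀ i n → A n ∙ x i ≡ A (suc n)
        idem      : A k ∙ A k ≡ A k

      A-+ : ∀ m n → A m ∙ A n ≡ A (suc (suc (m + n)))
      A-+ zero n = begin
        A 0 ∙ A n            ≡⟨ cong (_∙ A n) (ascending {0} {1} ≤-refl) ⟨
        (x 0 ∙ x 1) ∙ A n    ≡⟨ assoc _ _ _ ⟩
        x 0 ∙ (x 1 ∙ A n)    ≡⟨ cong (x 0 ∙_) (left 1 n) ⟩
        x 0 ∙ A (suc n)      ≡⟨ left 0 (suc n) ⟩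
        A (suc (suc n))      ∎
      A-+ (suc m) n = begin
        A (suc m) ∙ A n             ≡⟨ cong (_∙ A n) (left 0 m) ⟨
        (x 0 ∙ A m) ∙ A n           ≡⟨ assoc _ _ _ ⟩
        x 0 ∙ (A m ∙ A n)           ≡⟨ cong (x 0 ∙_) (A-+ m n) ⟩
        x 0 ∙ A (suc (suc (m + n))) ≡⟨ left 0 _ ⟩
        A (suc (suc (suc m + n)))   ∎

      IsA : S → Set
      IsA y = Σ ℕ λ n → y ≡ A n

      -- The length comes from `A (suc (suc (k + k)))` being `A k ∙ A k`, hence `A k`: later values
      -- repeat earlier ones.
      As : List S
      As = applyUpTo A (suc (suc (k + k)))

      A∈As : ∀ n → A n ∈ As
      A∈As n = let i , i< , eq = below n in subst (_∈ As) (sym eq) (∈-applyUpTo⁺ A i<)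
        where
        below : ∀ n → Σ ℕ λ i → i < suc (suc (k + k)) × A n ≡ A i
        below zero = 0 , s≤s z≤n , refl
        below (suc n) with below n
        ... | i , i< , eq with m≤n⇒m<n∨m≡n i<
        ... | inj₁ i+1< = suc i , i+1< , trans (sym (left 0 n)) (trans (cong (x 0 ∙_) eq) (left 0 i))
        ... | inj₂ refl = k , s≤s (m≤n⇒m≤1+n (m≤m+n k k)) , (begin
          A (suc n)                ≡⟨ left 0 n ⟨
          x 0 ∙ A n                ≡⟨ cong (x 0 ∙_) eq ⟩
          x 0 ∙ A (suc (k + k))    ≡⟨ left 0 _ ⟩
          A (suc (suc (k + k)))    ≡⟨ A-+ k k ⟨
          A k ∙ A k                ≡⟨ idem ⟩
          A k                      ∎)

      no-A-products : {z : Seq} → Bijective z → (∀ i j → IsA (z i ∙ z j)) → (∀ i n → IsA (z i ∙ A n)) →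
                      ¬ (∀ i n → IsA (A n ∙ z i))
      no-A-products z-inj zz zA Az = no-finite-products z-inj {IsA} {IsA} As
        (λ { (n , refl) → A∈As n }) id zz (λ { i (n , refl) → zA i n }) (λ { i (n , refl) → Az i n })
        λ { (m , refl) (n , refl) → _ , A-+ m n }

    homogeneous-∘ : ∀ {x φ} → Homogeneous x → Incr φ → Homogeneous (x ∘ φ)
    homogeneous-∘ {φ = φ} h φ↑ = record
      { A         = A
      ; k         = k
      ; injective = bijective-∘ injective φ↑
      ; ascending = λ i<j → ascending (incr-< φ↑ i<j)
      ; left      = left ∘ φ
      ; right     = right ∘ φ
      ; idem      = idem
      } where open Homogeneous h

    -- Descending pairs may have a sum `r` different from `A 0`; the difference vanishes as soon as
    -- a third term is added.
    record Symmetric (x : Seq) : Set where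
      field
        homogeneous : Homogeneous x
        r           : S
        descending  : ∀ {i j} → i < j → x j ∙ x i ≡ r
        left-r      : ∀ i → x i ∙ r ≡ Homogeneous.A homogeneous 1
        right-r     : ∀ i → r ∙ x i ≡ Homogeneous.A homogeneous 1

      open Homogeneous homogeneous public

      Pair : S → Set
      Pair y = y ≡ A 0 ⊎ y ≡ r

      distinct : ∀ {i j} → i ≢ j → Pair (x i ∙ x j)
      distinct {i} {j} i≢j with <-cmp i j
      ... | tri< i<j _ _ = inj₁ (ascending i<j)
      ... | tri≈ _ i≡j _ = contradiction i≡j i≢j
      ... | tri> _ _ j<i = inj₂ (descending j<i)

      left-pair : ∀ i {y} → Pair y → x i ∙ y ≡ A 1
      left-pair i (inj₁ refl) = left i 0
      left-pair i (inj₂ refl) = left-r i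

      right-pair : ∀ i {y} → Pair y → y ∙ x i ≡ A 1
      right-pair i (inj₁ refl) = right i 0
      right-pair i (inj₂ refl) = right-r i

      A-mult : ∀ i m n → A m ∙ mult (x i) n ≡ A (m + suc n)
      A-mult i m zero = trans (right i m) (cong A (sym (+-comm m 1)))
      A-mult i m (suc n) = begin
        A m ∙ (x i ∙ mult (x i) n)   ≡⟨ assoc _ _ _ ⟨
        (A m ∙ x i) ∙ mult (x i) n   ≡⟨ cong (_∙ mult (x i) n) (right i m) ⟩
        A (suc m) ∙ mult (x i) n     ≡⟨ A-mult i (suc m) n ⟩
        A (suc m + suc n)            ≡⟨ cong A (+-suc m (suc n)) ⟨
        A (m + suc (suc n))          ∎

      mult-A : ∀ i m n → mult (x i) m ∙ A n ≡ A (suc m + n)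
      mult-A i zero    n = left i n
      mult-A i (suc m) n = trans (assoc _ _ _) (trans (cong (x i ∙_) (mult-A i m n)) (left i _))

      pair-mult : ∀ i {y} → Pair y → ∀ n → y ∙ mult (x i) n ≡ A (suc n)
      pair-mult i p zero = right-pair i p
      pair-mult i p (suc n) =
        trans (sym (assoc _ _ _)) (trans (cong (_∙ mult (x i) n) (right-pair i p)) (A-mult i 1 n))

      mult-pair : ∀ i {y} → Pair y → ∀ n → mult (x i) n ∙ y ≡ A (suc n)
      mult-pair i p zero = left-pair i p
      mult-pair i p (suc n) = trans (assoc _ _ _) (trans (cong (x i ∙_) (mult-pair i p n)) (left i (suc n)))

      -- Two factors with distinct indices may give `r`, but three or more give the value of `A` at
      -- their number minus two. Hence one side of each cross product carries a `suc`.
      cross₁ : ∀ {i j} → i ≢ j → ∀ m → mult (x i) (suc m) ∙ x j ≡ A (suc m)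
      cross₁ {i} i≢j zero = trans (assoc _ _ _) (left-pair i (distinct i≢j))
      cross₁ {i} i≢j (suc m) = trans (assoc _ _ _) (trans (cong (x i ∙_) (cross₁ i≢j m)) (left i (suc m)))

      crossʳ : ∀ {i j} → i ≢ j → ∀ m n → mult (x i) m ∙ mult (x j) (suc n) ≡ A (m + suc n)
      crossʳ {i} {j} i≢j zero n = trans (sym (assoc _ _ _)) (pair-mult j (distinct i≢j) n)
      crossʳ {i} {j} i≢j (suc m) n =
        trans (sym (assoc _ _ _)) (trans (cong (_∙ mult (x j) n) (cross₁ i≢j m)) (A-mult j (suc m) n))

      crossˡ : ∀ {i j} → i ≢ j → ∀ m n → mult (x i) (suc m) ∙ mult (x j) n ≡ A (suc m + n)
      crossˡ i≢j m zero    = trans (cross₁ i≢j m) (cong A (sym (+-identityʳ (suc m))))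
      crossˡ i≢j m (suc n) = crossʳ i≢j (suc m) n

      -- If multiples become constant at `suc κ`, then `v` is a multiple of every `x (φ j)`.
      -- Choosing another index turns its products with multiples of `x (φ i)` into cross products,
      -- so type (a) arises from `z`.
      module _ {κ : ℕ} {φ : ℕ → ℕ} {v : S} (φ↑ : Incr φ) (z-inj : Bijective λ i → mult (x (φ i)) κ)
               (next≡v : ∀ i → mult (x (φ i)) (suc κ) ≡ v) where

        private
          z : Seq
          z i = mult (x (φ i)) κ

          P : S → Set
          P y = Pair y ⊎ y ≡ v ⊎ IsA y

          φ-≢ : ∀ {i j} → i ≢ j → φ i ≢ φ j
          φ-≢ i≢j eq = i≢j (incr-injective φ↑ eq)

          v-right : ∀ i m → IsA (mult (x (φ i)) m ∙ v)
          v-right i m = _ , trans (cong (mult (x (φ i)) m ∙_) (sym (next≡v (suc i)))) (crossʳ (φ-≢ (1+n≢n ∘ sym)) m κ)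

          v-left : ∀ i m → IsA (v ∙ mult (x (φ i)) m)
          v-left i m = _ , trans (cong (_∙ mult (x (φ i)) m) (sym (next≡v (suc i)))) (crossˡ (φ-≢ 1+n≢n) κ m)

          square : ∀ i → P (z i ∙ z i)
          square i = go κ (next≡v i)
            where
            go : ∀ κ → mult (x (φ i)) (suc κ) ≡ v → P (mult (x (φ i)) κ ∙ mult (x (φ i)) κ)
            go zero eq = inj₂ (inj₁ eq)
            -- One factor of the square is regrouped to the left to produce `v`.
            go (suc m) eq = inj₂ (inj₂ (subst IsA (begin
              v ∙ mult y m                               ≡⟨ cong (_∙ mult y m) eq ⟨
              mult y (suc (suc m)) ∙ mult y m            ≡⟨ mult-+ y (suc (suc m)) m ⟩
              mult y (suc (suc (suc m) + m))             ≡⟨ cong (λ n → mult y (2 + n)) (+-suc m m) ⟨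
              mult y (suc (suc m + suc m))               ≡⟨ mult-+ y (suc m) (suc m) ⟨
              mult y (suc m) ∙ mult y (suc m)            ∎) (v-left i m)))
              where y = x (φ i)

          products : ∀ i j → P (z i ∙ z j)
          products i j with i ≟ j
          ... | yes refl = square i
          ... | no i≢j   = go κ
            where
            go : ∀ κ → P (mult (x (φ i)) κ ∙ mult (x (φ j)) κ)
            go zero    = inj₁ (distinct (φ-≢ i≢j))
            go (suc m) = inj₂ (inj₂ (_ , crossʳ (φ-≢ i≢j) (suc m) m))

        next-not-constant : ⊥
        next-not-constant = no-finite-products z-inj {P} {IsA} (r ∷ v ∷ As)
          (λ { (inj₁ (inj₁ refl)) → there (there (A∈As 0)) ; (inj₁ (inj₂ refl)) → here refl
             ; (inj₂ (inj₁ refl)) → there (here refl) ; (inj₂ (inj₂ (n , refl))) → there (there (A∈As n)) })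
          (inj₂ ∘ inj₂) products
          (λ { i (inj₁ p) → _ , mult-pair (φ i) p κ ; i (inj₂ (inj₁ refl)) → v-right i κ
             ; i (inj₂ (inj₂ (n , refl))) → _ , mult-A (φ i) κ n })
          (λ { i (n , refl) → _ , A-mult (φ i) n κ }) λ { (m , refl) (n , refl) → _ , A-+ m n }

      injective-multiples : ∀ κ → Σ (ℕ → ℕ) λ φ → Incr φ × Bijective λ i → mult (x (φ i)) κ
      injective-multiples zero = id , n<1+n , injective
      injective-multiples (suc κ) with injective-multiples κ
      ... | φ , φ↑ , z-inj with const⊎injective (λ i → mult (x (φ i)) (suc κ)) everywhere
      ... | inj₂ (ψ , ψ↑ , _ , inj) = φ ∘ ψ , incr-∘ φ↑ ψ↑ , inj
      ... | inj₁ (v , inf) =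
        let ψ , ψ↑ , eq = enumerate inf
        in ⊥-elim (next-not-constant {κ} (incr-∘ φ↑ ψ↑) (bijective-∘ z-inj ψ↑) (λ i → proj₂ (eq i)))

      null : Σ Seq λ w → Null w (A k)
      null =
        -- With (k + 2)-fold multiples, products of two distinct terms, or of a term and `A k`, have
        -- 2k + 4 factors and equal `A k` by idempotence.
        let φ , φ↑ , w-inj = injective-multiples (suc k) in (λ i → mult (x (φ i)) (suc k)) , record
          { injective = w-inj
          ; distinct  = λ i≢j → trans (crossˡ (i≢j ∘ incr-injective φ↑) k (suc k))
                                  (trans (cong (A ∘ suc) (+-suc k k)) double)
          ; zeroˡ     = λ i → trans (A-mult (φ i) k (suc k))
                                  (trans (cong A (trans (+-suc k (suc k)) (cong suc (+-suc k k)))) double)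
          ; zeroʳ     = λ i → trans (mult-A (φ i) (suc k) k) double
          ; idem      = idem
          }
        where
        double : A (suc (suc (k + k))) ≡ A k
        double = trans (sym (A-+ k k)) idem

    -- From homogeneous to symmetric sequences

    module _ {x : Seq} (h : Homogeneous x) where

      open Homogeneous h

      -- Writing `z j` with a first index `m` beyond `q i` makes the two middle factors of
      -- `z i ∙ z j` ascending. All products are then values of `A`, which gives type (a).
      no-descending : {z : Seq} {q : ℕ → ℕ} → Bijective z →
                      ¬ (∀ i j → Σ ℕ λ m → q i < m × z j ≡ x m ∙ x (q j))
      no-descending {z} {q} z-inj rep = no-A-products z-inj zz zA Az
        where
        zA : ∀ i n → IsA (z i ∙ A n)
        zA i n = let m , _ , eq = rep i i in suc (suc n) , (begin
          z i ∙ A n                 ≡⟨ cong (_∙ A n) eq ⟩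
          (x m ∙ x (q i)) ∙ A n     ≡⟨ assoc _ _ _ ⟩
          x m ∙ (x (q i) ∙ A n)     ≡⟨ cong (x m ∙_) (left (q i) n) ⟩
          x m ∙ A (suc n)           ≡⟨ left m (suc n) ⟩
          A (suc (suc n))           ∎)
        Az : ∀ i n → IsA (A n ∙ z i)
        Az i n = let m , _ , eq = rep i i in suc (suc n) , (begin
          A n ∙ z i                 ≡⟨ cong (A n ∙_) eq ⟩
          A n ∙ (x m ∙ x (q i))     ≡⟨ assoc _ _ _ ⟨
          (A n ∙ x m) ∙ x (q i)     ≡⟨ cong (_∙ x (q i)) (right m n) ⟩
          A (suc n) ∙ x (q i)       ≡⟨ right (q i) (suc n) ⟩
          A (suc (suc n))           ∎)
        zz : ∀ i j → IsA (z i ∙ z j)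
        zz i j = let l , _ , eqᵢ = rep i i ; m , lt , eqⱼ = rep i j in 2 , (begin
          z i ∙ z j                               ≡⟨ cong₂ _∙_ eqᵢ eqⱼ ⟩
          (x l ∙ x (q i)) ∙ (x m ∙ x (q j))       ≡⟨ assoc _ _ _ ⟩
          x l ∙ (x (q i) ∙ (x m ∙ x (q j)))       ≡⟨ cong (x l ∙_) (assoc _ _ _) ⟨
          x l ∙ ((x (q i) ∙ x m) ∙ x (q j))       ≡⟨ cong (λ y → x l ∙ (y ∙ x (q j))) (ascending lt) ⟩
          x l ∙ (A 0 ∙ x (q j))                   ≡⟨ cong (x l ∙_) (right (q j) 0) ⟩
          x l ∙ A 1                               ≡⟨ left l 1 ⟩
          A 2                                     ∎)

      constant-descending : ∀ {v} → (∀ {i j} → i < j → x j ∙ x i ≡ v) → Symmetric (x ∘ suc)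
      constant-descending {v} desc = record
        -- The term `x 0` is set aside, to write `v` as `x j ∙ x 0` with any later `j`.
        { homogeneous = homogeneous-∘ h λ n → n<1+n (suc n)
        ; r           = v
        ; descending  = λ i<j → desc (s≤s i<j)
        ; left-r      = λ i → begin
            x (suc i) ∙ v                              ≡⟨ cong (x (suc i) ∙_) (desc {0} {suc (suc i)} (s≤s z≤n)) ⟨
            x (suc i) ∙ (x (suc (suc i)) ∙ x 0)        ≡⟨ assoc _ _ _ ⟨
            (x (suc i) ∙ x (suc (suc i))) ∙ x 0        ≡⟨ cong (_∙ x 0) (ascending (n<1+n (suc i))) ⟩
            A 0 ∙ x 0                                  ≡⟨ right 0 0 ⟩
            A 1                                        ∎
        ; right-r     = λ i → begin
            v ∙ x (suc i)                              ≡⟨ cong (_∙ x (suc i)) (desc {0} {suc i} (s≤s z≤n)) ⟨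
            (x (suc i) ∙ x 0) ∙ x (suc i)              ≡⟨ assoc _ _ _ ⟩
            x (suc i) ∙ (x 0 ∙ x (suc i))              ≡⟨ cong (x (suc i) ∙_) (ascending {0} {suc i} (s≤s z≤n)) ⟩
            x (suc i) ∙ A 0                            ≡⟨ left (suc i) 0 ⟩
            A 1                                        ∎
        }

    -- Two uses of `no-descending`: for fixed `i` the products `x n ∙ x i` cannot be injective along
    -- a subsequence, and neither can their limits `r i`.
    symmetric : ∀ {x} → Homogeneous x → Σ Seq Symmetric
    symmetric {x} h = let φ , φ↑ , r , hom = end-homogeneous {f = λ i n → x n ∙ x i} limit in finish φ↑ r hom
      where
      limit : ∀ i {P} → Inf P → (∀ n → P n → i < n) → Σ S λ v → Inf (λ n → P n × x n ∙ x i ≡ v)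
      limit i inf i< with const⊎injective (λ n → x n ∙ x i) inf
      ... | inj₁ c = c
      ... | inj₂ (φ , φ↑ , φ∈ , inj) =
        ⊥-elim (no-descending h {q = λ _ → i} inj λ _ j → φ j , i< _ (φ∈ j) , refl)

      finish : ∀ {φ} → Incr φ → (r : Seq) → (∀ {i j} → i < j → x (φ j) ∙ x (φ i) ≡ r i) → Σ Seq Symmetric
      finish {φ} φ↑ r hom with const⊎injective r everywhere
      ... | inj₁ (v , inf) =
        let ψ , ψ↑ , eq = enumerate inf
        in x ∘ φ ∘ ψ ∘ suc , constant-descending (homogeneous-∘ h (incr-∘ φ↑ ψ↑))
             (λ {i} i<j → trans (hom (incr-< ψ↑ i<j)) (proj₂ (eq i)))
      ... | inj₂ (ψ , ψ↑ , _ , inj) = ⊥-elim (no-descending h {q = φ ∘ ψ} inj λ i j →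
        -- An index above `ψ i`, as `no-descending` demands, and above `ψ j`, so that `hom` applies.
        φ (suc (ψ i + ψ j)) , incr-< φ↑ (s≤s (m≤m+n (ψ i) (ψ j))) , sym (hom (s≤s (m≤n+m (ψ j) (ψ i)))))

    no-homogeneous : ∀ {x} → ¬ Homogeneous x
    no-homogeneous h = no-null (proj₂ (Symmetric.null (proj₂ (symmetric h))))

    -- Bracketing three terms in two ways shows that from index 2 on all `x k` act alike on `s` from
    -- both sides. Once terms equal to `e` are dropped, `e` is a sum of at least two terms, hence
    -- some `A k`.
    constant⇒homogeneous : ∀ {x e s} → Bijective x → e ∙ e ≡ e → Unavoidable x e →
                           (∀ {i j} → i < j → x i ∙ x j ≡ s) → Σ Seq Homogeneous
    constant⇒homogeneous {x} {e} {s} x-inj idem u const = z , record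
      { A         = A
      ; k         = proj₁ e≡A
      ; injective = z-inj
      ; ascending = z-const
      ; left      = left
      ; right     = right
      ; idem      = subst (λ y → y ∙ y ≡ y) (proj₂ e≡A) idem
      }
      where
      y : Seq
      y = drop 2 x
      avoids = injective-avoids (drop-injective 2 x-inj) (e ∷ [])
      N : ℕ
      N = proj₁ avoids
      z : Seq
      z = drop N y
      z≢e : ∀ i → e ≢ z i
      z≢e i eq = proj₂ avoids (N + i) (m≤m+n N i) (here (sym eq))
      z-inj : Bijective z
      z-inj = drop-injective N (drop-injective 2 x-inj)
      z-const : ∀ {i j} → i < j → z i ∙ z j ≡ s
      z-const i<j = const (s≤s (s≤s (+-monoʳ-< N i<j)))
      exchange : ∀ i {k} → suc i < k → x i ∙ s ≡ s ∙ x k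
      exchange i {k} lt = begin
        x i ∙ s                     ≡⟨ cong (x i ∙_) (const lt) ⟨
        x i ∙ (x (suc i) ∙ x k)     ≡⟨ assoc _ _ _ ⟨
        (x i ∙ x (suc i)) ∙ x k     ≡⟨ cong (_∙ x k) (const (n<1+n i)) ⟩
        s ∙ x k                     ∎
      t : S
      t = x 0 ∙ s
      s∙y : ∀ i → s ∙ y i ≡ t
      s∙y i = sym (exchange 0 (s≤s (s≤s z≤n)))
      y∙s : ∀ i → y i ∙ s ≡ t
      y∙s i = trans (exchange (2 + i) {2 + (2 + i)} ≤-refl) (s∙y (2 + i))
      A : ℕ → S
      A zero    = s
      A (suc n) = z 0 ∙ A n
      right : ∀ i n → A n ∙ z i ≡ A (suc n)
      right i zero    = trans (s∙y (N + i)) (sym (y∙s (N + 0)))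
      right i (suc n) = trans (assoc _ _ _) (cong (z 0 ∙_) (right i n))
      left : ∀ i n → z i ∙ A n ≡ A (suc n)
      left i zero    = trans (y∙s (N + i)) (sym (y∙s (N + 0)))
      left i (suc n) = begin
        z i ∙ A (suc n)       ≡⟨ cong (z i ∙_) (right 0 n) ⟨
        z i ∙ (A n ∙ z 0)     ≡⟨ assoc _ _ _ ⟨
        (z i ∙ A n) ∙ z 0     ≡⟨ cong (_∙ z 0) (left i n) ⟩
        A (suc n) ∙ z 0       ≡⟨ right 0 (suc n) ⟩
        A (suc (suc n))       ∎
      classify : ∀ {m n v} → Sum z m n v → (Σ ℕ λ j → m ≤ j × v ≡ z j) ⊎ (Σ ℕ λ k → v ≡ A k)
      classify (last m≤i _) = inj₁ (_ , m≤i , refl)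
      classify (cons {i = i} _ p) with classify p
      ... | inj₁ (j , i<j , refl) = inj₂ (0 , z-const i<j)
      ... | inj₂ (k , refl)       = inj₂ (suc k , left i k)
      e≡A : Σ ℕ λ k → e ≡ A k
      e≡A with classify (proj₂ (u (⊑-weaken z≤n (⊑-trans (drop-⊑ N) (drop-⊑ 2))) z-inj))
      ... | inj₁ (j , _ , eq) = ⊥-elim (z≢e j eq)
      ... | inj₂ k = k

    no-constant : ∀ {x e s} → Bijective x → e ∙ e ≡ e → Unavoidable x e →
                  ¬ (∀ {i j} → i < j → x i ∙ x j ≡ s)
    no-constant x-inj idem u const = no-homogeneous (proj₂ (constant⇒homogeneous x-inj idem u const))

theorem3p4 : (S : Set) (_+_ : S → S → S) → IsSemigroup (_≡_ {A = S}) _+_ →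
  ExcludedMiddle (Level.suc 0ℓ) →
  let
    c1 = ∀ (A : S → Set) (k : ℕ) (c : S → Fin k) → ProperIP _+_ A →
           Σ (Fin k) λ i → ProperIP _+_ (λ x → A x × c x ≡ i)
    c2 = ∀ (a : ℕ → S) → Bijective a →
           Σ (ℕ → S) λ b → Sumsequence _+_ a b × Proper _+_ b
    c3 = (¬ (Σ (S → Set) λ T → IsSubsemigroup _+_ T × InfiniteP T × FiniteP (_⊕_ _+_ T T)))
         × (¬ Embeds _+_ fan) × (¬ Embeds _+_ _⊞_)
    c4 = ∀ (a : ℕ → S) → Bijective a → (k : ℕ) (c : S → Fin k) →
           Σ (ℕ → S) λ b → Sumsequence _+_ a b × Bijective b × Monochromatic _+_ c (FS _+_ b)
    c5 = ∀ (a : ℕ → S) → Bijective a → (k : ℕ) (c : S → Fin k) →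
           Σ (ℕ → S) λ b → Sumsequence _+_ a b × Proper _+_ b × Monochromatic _+_ c (FS _+_ b)
  in (c1 ⇔ c2) × (c2 ⇔ c3) × (c3 ⇔ c4) × (c4 ⇔ c5)
theorem3p4 S _+_ isSemigroup em = mk⇔ 1⇒2 2⇒1 , mk⇔ 2⇒3 3⇒2 , mk⇔ 3⇒4 4⇒3 , mk⇔ 4⇒5 5⇒4
  where
  open Implications _+_ (IsSemigroup.assoc isSemigroup) em
  open Unavoidability _+_ (IsSemigroup.assoc isSemigroup) em
  open Forbidden _+_ (IsSemigroup.assoc isSemigroup) em
  3⇒2 : C3 → C2
  3⇒2 c3 = ConstantPairs.proper-sumsequence (no-constant c3)
  4⇒3 : C4 → C3
  4⇒3 = 1⇒3 ∘ 4⇒1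
  2⇒3 : C2 → C3
  2⇒3 = 4⇒3 ∘ 5⇒4 ∘ 2⇒5
  1⇒2 : C1 → C2
  1⇒2 = 3⇒2 ∘ 1⇒3
  2⇒1 : C2 → C1
  2⇒1 = 4⇒1 ∘ 5⇒4 ∘ 2⇒5
  3⇒4 : C3 → C4
  3⇒4 = 5⇒4 ∘ 2⇒5 ∘ 3⇒2
  4⇒5 : C4 → C5
  4⇒5 = 2⇒5 ∘ 3⇒2 ∘ 4⇒3
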